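{- There is an absolute constant $C>0$ such that for all integers $d\ge 2$ and $n\ge 1$ the following holds. Let $G$ be a directed $d$-regular graph on $n$ vertices, and let $\sigma$ be a cycle-factor of $G$ chosen uniformly at random among all cycle-factors of $G$. Then the expected number of cycles of $\sigma$ is at most $C\cdot\frac{n\log d}{d}$.
   Context: A directed graph may have loops and directed cycles of length $2$, but no parallel edges. A directed graph is $d$-regular if every vertex has in-degree exactly $d$ and out-degree exactly $d$ (a loop contributes $1$ to both). A cycle-factor of a directed graph $G$ is a partition of its vertex set into directed cycles (a loop is a cycle of length $1$); equivalently, it is a permutation $\sigma$ of $V(G)$ such that $(v,\sigma(v))\in E(G)$ for every vertex $v$, and its cycles are the cycles of this permutation. Every directed $d$-regular graph has at least one cycle-factor. -}

module Defs where

open import Data.Nat using (ℕ; zero; suc; _+_; _≤ᵇ_)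
open import Data.Bool using (Bool; true; false; if_then_else_; _∧_; _∨_; not)
open import Data.Fin using (Fin; toℕ; _≟_)
open import Data.List using (List; []; _∷_; [_]; map; concatMap; allFin)
open import Data.Nat.ListAction using (sum)
open import Data.Bool.ListAction using (and)
open import Data.Vec using (Vec; lookup) renaming ([] to []ᵥ; _∷_ to _∷ᵥ_)
open import Data.Product using (_×_)
open import Relation.Nullary.Decidable using (⌊_⌋)
open import Relation.Binary.PropositionalEquality using (_≡_)

-- A directed graph on vertex set Fin n, loops allowed, no parallel edges:
-- G u v = true iff (u , v) is an edge.
Digraph : ℕ → Set
Digraph n = Fin n → Fin n → Bool

countFin : {n : ℕ} → (Fin n → Bool) → ℕ
countFin {n} p = sum (map (λ v → if p v then 1 else 0) (allFin n))

allB : {n : ℕ} → (Fin n → Bool) → Bool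
allB {n} p = and (map p (allFin n))

outdeg : {n : ℕ} → Digraph n → Fin n → ℕ
outdeg G v = countFin (λ u → G v u)

indeg : {n : ℕ} → Digraph n → Fin n → ℕ
indeg G v = countFin (λ u → G u v)

Regular : {n : ℕ} → ℕ → Digraph n → Set
Regular {n} d G = (v : Fin n) → (outdeg G v ≡ d) × (indeg G v ≡ d)

-- all maps Fin n → Fin n, represented as vectors of images (v ↦ lookup σ v)
allVecs : (n k : ℕ) → List (Vec (Fin n) k)
allVecs n zero = [ []ᵥ ]
allVecs n (suc k) = concatMap (λ i → map (i ∷ᵥ_) (allVecs n k)) (allFin n)

-- σ is injective (hence a permutation of the finite set Fin n)
isInjective : {n : ℕ} → Vec (Fin n) n → Bool
isInjective σ = allB (λ u → allB (λ v → ⌊ u ≟ v ⌋ ∨ not ⌊ lookup σ u ≟ lookup σ v ⌋))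

isCycleFactor : {n : ℕ} → Digraph n → Vec (Fin n) n → Bool
isCycleFactor G σ = isInjective σ ∧ allB (λ v → G v (lookup σ v))

filterB : {A : Set} → (A → Bool) → List A → List A
filterB p [] = []
filterB p (x ∷ xs) = if p x then x ∷ filterB p xs else filterB p xs

-- the list of all cycle-factors of G (each exactly once)
cycleFactors : {n : ℕ} → Digraph n → List (Vec (Fin n) n)
cycleFactors {n} G = filterB (isCycleFactor G) (allVecs n n)

iter : {n : ℕ} → Vec (Fin n) n → ℕ → Fin n → Fin n
iter σ zero v = v
iter σ (suc k) v = lookup σ (iter σ k v)

-- v is the smallest vertex on its cycle of σ (the orbit of v is
-- {σ^k v : 0 ≤ k < n} since cycles have length ≤ n)
isCycleMin : {n : ℕ} → Vec (Fin n) n → Fin n → Bool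
isCycleMin {n} σ v = allB {n} (λ k → toℕ v ≤ᵇ toℕ (iter σ (toℕ k) v))

numCycles : {n : ℕ} → Vec (Fin n) n → ℕ
numCycles σ = countFin (isCycleMin σ)

module Submission where

-- Let Z₁ be the number of cycle-factors and Z₂ the sum of 2^(number of cycles) over them. By
-- convexity of 2ˣ it suffices that (Z₂ / Z₁)ᵈ ≤ d^O(n), which follows from Z₂ᵈ ≤ ((d+1)!)ⁿ and
-- Z₁ ≥ (d ((d−1)/d)ᵈ)ⁿ, both within d^O(n/d) of (d/e)ⁿ.
-- Upper bound (as in Brègman's theorem): reveal σ along a vertex order, each admissible value being
-- equally likely except that the one closing a cycle counts twice. With N_v admissible values at v,
-- the sum over σ of 2^cycles / ∏ (N_v + 1) is at most 1. Averaging over all orders by AM-GM, N_v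
-- is uniform on {1, …, d}, and each σ keeps a weight of at least ((d+1)!)^(−n/d).
-- Lower bound (capacity): ∏ᵥ ∑ x_w, the inner sum over the edges w → v, is at least dⁿ ∏ x_w by AM-GM,
-- and its multilinear coefficient is Z₁. Extracting the linear coefficient in one variable loses a
-- factor ((d−1)/d)ᵈ, because the polynomial is log-concave in that variable.

open import Defs
open import Algebra.Structures using (IsCommutativeMonoid)
open import Data.Bool using (Bool; true; false; if_then_else_; _∧_; _∨_; not)
open import Data.Bool.ListAction using (and)
open import Data.Bool.Properties using (T-≡)
open import Data.Empty using (⊥-elim)
open import Data.Fin using (Fin; zero; suc; toℕ; fromℕ<; punchOut; _≟_)
open import Data.Fin.Permutation.Components using (transpose; transpose-inverse)
open import Data.Fin.Properties using (pigeonhole; injective⇒≤; punchOut-injective; any?; toℕ-injective; toℕ-fromℕ<; toℕ<n)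
open import Data.List using (List; []; _∷_; map; foldr; length; _++_; concatMap; allFin; lookup; tabulate; reverse; _ʳ++_; cartesianProductWith)
open import Data.List.Membership.Propositional using (_∈_; _∉_)
open import Data.List.Membership.Propositional.Properties using (∈-allFin; ∈-lookup; ∈-map⁺; ∈-map⁻; ∈-cartesianProductWith⁺)
open import Data.List.Properties using (length-map; length-tabulate; map-∘; map-cong)
open import Data.List.Relation.Binary.Permutation.Propositional using (_↭_) renaming (refl to ↭-refl; prep to ↭-prep; swap to ↭-swap; trans to ↭-trans)
open import Data.List.Relation.Binary.Permutation.Propositional.Properties using (↭-length; ↭-reverse; map⁺)
open import Data.List.Relation.Unary.All using ([]; _∷_)
import Data.List.Relation.Unary.All as All
open import Data.List.Relation.Unary.AllPairs using ([]; _∷_)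
open import Data.List.Relation.Unary.Any using (here; there; index)
open import Data.List.Relation.Unary.Any.Properties using (lookup-index)
open import Data.List.Relation.Unary.Unique.Propositional using (Unique)
open import Data.List.Relation.Unary.Unique.Propositional.Properties using (allFin⁺; cartesianProductWith⁺) renaming (map⁺ to unique-map⁺)
open import Data.Nat hiding (_≟_; _⊔_)
open import Data.Nat.DivMod using (_/_; _%_; m≡m%n+[m/n]*n; m%n<n; m/n*n≡m; m/n*n≤m)
open import Data.Nat.Divisibility using (∣-trans; m∣m*n; m≤n⇒m!∣n!)
open import Data.Nat.ListAction using (sum)
open import Data.Nat.ListAction.Properties using (sum-↭)
open import Data.Nat.Logarithm using (⌊log₂_⌋; ⌊log₂⌋-mono-≤; ⌊log₂[2^n]⌋≡n)
open import Data.Nat.Properties hiding (_≟_)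
open import Data.Nat.Tactic.RingSolver using (solve-∀)
open import Data.Product using (∃-syntax; _×_; _,_; proj₁; proj₂)
open import Data.Sum using (_⊎_; inj₁; inj₂; [_,_]′)
open import Data.Vec using (Vec) renaming ([] to []ᵥ; _∷_ to _∷ᵥ_; lookup to lookupᵥ; map to mapᵥ; tabulate to tabulateᵥ)
open import Data.Vec.Properties using (tabulate∘lookup; tabulate-cong; lookup-map; lookup∘tabulate) renaming (∷-injective to ∷ᵥ-injective)
open import Function using (_∘_; id; Equivalence; Injective)
open import Relation.Binary.PropositionalEquality
open import Relation.Nullary using (yes; no; contradiction)
open import Relation.Nullary.Decidable using (⌊_⌋; dec-true)

-- Doubling the value that closes a cycle turns the d! of Brègman's bound only into (d+1)!, a factor
-- (d+1)ⁿ in Z₂ᵈ. This is the whole price of the weight 2^cycles, and it is still d^O(n). In the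
-- lower bound, log-concavity has to survive the extraction of the earlier variables. So no
-- intermediate polynomial is expanded: each is kept as the product of the linear forms
-- differentiated along the columns extracted so far, and the ratios of such expressions are
-- monotone at every stage. For a monotone log-concave function one extraction loses at most a
-- factor 1/e, with e Euler's number. Walking N steps along a ray replaces 1/e by ((N-1)/N)^N and
-- keeps the argument within the natural numbers. There N is a free parameter and not a degree; N =
-- d is fine enough for the final estimate. For the same reason d-th roots are replaced by
-- comparisons of d-th powers, and the weights 1/(N_v + 1) are multiplied by (d+1)!.

𝟙 : Bool → ℕ
𝟙 b = if b then 1 else 0

-- Iterated operations of a commutative monoid, giving sums and products over lists.

module BigOp {_∙_ : ℕ → ℕ → ℕ} {ε : ℕ} (isCM : IsCommutativeMonoid _≡_ _∙_ ε) where
  open IsCommutativeMonoid isCM using (assoc; comm; identityˡ; identityʳ)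

  ⨀ : {A : Set} → List A → (A → ℕ) → ℕ
  ⨀ xs f = foldr _∙_ ε (map f xs)

  interchange : ∀ a b c d → (a ∙ b) ∙ (c ∙ d) ≡ (a ∙ c) ∙ (b ∙ d)
  interchange a b c d = begin
    (a ∙ b) ∙ (c ∙ d) ≡⟨ assoc a b (c ∙ d) ⟩
    a ∙ (b ∙ (c ∙ d)) ≡⟨ cong (a ∙_) (assoc b c d) ⟨
    a ∙ ((b ∙ c) ∙ d) ≡⟨ cong (λ z → a ∙ (z ∙ d)) (comm b c) ⟩
    a ∙ ((c ∙ b) ∙ d) ≡⟨ cong (a ∙_) (assoc c b d) ⟩
    a ∙ (c ∙ (b ∙ d)) ≡⟨ assoc a c (b ∙ d) ⟨
    (a ∙ c) ∙ (b ∙ d) ∎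
    where open ≡-Reasoning

  module _ {A : Set} where

    cong∈ : {f g : A → ℕ} (xs : List A) → (∀ {x} → x ∈ xs → f x ≡ g x) → ⨀ xs f ≡ ⨀ xs g
    cong∈ []       h = refl
    cong∈ (x ∷ xs) h = cong₂ _∙_ (h (here refl)) (cong∈ xs (h ∘ there))

    congᵉ : {f g : A → ℕ} (xs : List A) → (∀ x → f x ≡ g x) → ⨀ xs f ≡ ⨀ xs g
    congᵉ xs h = cong∈ xs (λ {x} _ → h x)

    ⨀-ε : (xs : List A) → ⨀ xs (λ _ → ε) ≡ ε
    ⨀-ε []       = refl
    ⨀-ε (x ∷ xs) = trans (identityˡ _) (⨀-ε xs)

    ⨀-∙ : (xs : List A) (f g : A → ℕ) → ⨀ xs (λ x → f x ∙ g x) ≡ ⨀ xs f ∙ ⨀ xs g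
    ⨀-∙ []       f g = sym (identityˡ ε)
    ⨀-∙ (x ∷ xs) f g = trans (cong ((f x ∙ g x) ∙_) (⨀-∙ xs f g)) (interchange _ _ _ _)

    ⨀-map : {B : Set} (g : A → B) (xs : List A) (f : B → ℕ) → ⨀ (map g xs) f ≡ ⨀ xs (f ∘ g)
    ⨀-map g xs f = cong (foldr _∙_ ε) (sym (map-∘ xs))

    ⨀-++ : (xs ys : List A) (f : A → ℕ) → ⨀ (xs ++ ys) f ≡ ⨀ xs f ∙ ⨀ ys f
    ⨀-++ []       ys f = sym (identityˡ _)
    ⨀-++ (x ∷ xs) ys f = trans (cong (f x ∙_) (⨀-++ xs ys f)) (sym (assoc _ _ _))

  ⨀-concatMap : {A B : Set} (g : A → List B) (xs : List A) (f : B → ℕ) →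
                ⨀ (concatMap g xs) f ≡ ⨀ xs (λ x → ⨀ (g x) f)
  ⨀-concatMap g []       f = refl
  ⨀-concatMap g (x ∷ xs) f =
    trans (⨀-++ (g x) (concatMap g xs) f) (cong (⨀ (g x) f ∙_) (⨀-concatMap g xs f))

  ⨀-swap : {A B : Set} (xs : List A) (ys : List B) (f : A → B → ℕ) →
           ⨀ xs (λ x → ⨀ ys (f x)) ≡ ⨀ ys (λ y → ⨀ xs (λ x → f x y))
  ⨀-swap []       ys f = sym (⨀-ε ys)
  ⨀-swap (x ∷ xs) ys f =
    trans (cong (⨀ ys (f x) ∙_) (⨀-swap xs ys f)) (sym (⨀-∙ ys (f x) _))

  ⨀-filterB : {A : Set} (p : A → Bool) (xs : List A) (f : A → ℕ) →
              ⨀ (filterB p xs) f ≡ ⨀ xs (λ x → if p x then f x else ε)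
  ⨀-filterB p []       f = refl
  ⨀-filterB p (x ∷ xs) f with p x
  ... | true  = cong (f x ∙_) (⨀-filterB p xs f)
  ... | false = trans (⨀-filterB p xs f) (sym (identityˡ _))

  module _ {n : ℕ} where

    δ-∉ : (xs : List (Fin n)) (j : Fin n) (f : Fin n → ℕ) → j ∉ xs →
          ⨀ xs (λ i → if ⌊ i ≟ j ⌋ then f i else ε) ≡ ε
    δ-∉ []       j f j∉ = refl
    δ-∉ (x ∷ xs) j f j∉ with x ≟ j
    ... | yes refl = ⊥-elim (j∉ (here refl))
    ... | no  _    = trans (identityˡ _) (δ-∉ xs j f (j∉ ∘ there))

    δ-∈ : {xs : List (Fin n)} (j : Fin n) (f : Fin n → ℕ) → Unique xs → j ∈ xs →
          ⨀ xs (λ i → if ⌊ i ≟ j ⌋ then f i else ε) ≡ f j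
    δ-∈ {x ∷ xs} j f (x∉ ∷ u) j∈ with x ≟ j
    ... | yes refl =
      trans (cong (f x ∙_) (δ-∉ xs x f (λ x∈ → All.lookup x∉ x∈ refl))) (identityʳ _)
    δ-∈ {x ∷ xs} j f (x∉ ∷ u) (here refl) | no x≢j = ⊥-elim (x≢j refl)
    δ-∈ {x ∷ xs} j f (x∉ ∷ u) (there j∈)  | no x≢j = trans (identityˡ _) (δ-∈ j f u j∈)

    δ-allFin : (j : Fin n) (f : Fin n → ℕ) →
               ⨀ (allFin n) (λ i → if ⌊ i ≟ j ⌋ then f i else ε) ≡ f j
    δ-allFin j f = δ-∈ j f (allFin⁺ n) (∈-allFin j)

    δ-allFin′ : (j : Fin n) (f : Fin n → ℕ) →
                ⨀ (allFin n) (λ i → if ⌊ j ≟ i ⌋ then f i else ε) ≡ f j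
    δ-allFin′ j f = trans (congᵉ (allFin n) flip≟) (δ-allFin j f)
      where
      flip≟ : ∀ i → (if ⌊ j ≟ i ⌋ then f i else ε) ≡ (if ⌊ i ≟ j ⌋ then f i else ε)
      flip≟ i with j ≟ i | i ≟ j
      ... | yes _ | yes _ = refl
      ... | no  _ | no  _ = refl
      ... | yes p | no  q = ⊥-elim (q (sym p))
      ... | no  p | yes q = ⊥-elim (p (sym q))

    ⨀-reindex : {f : Fin n → Fin n} → Injective _≡_ _≡_ f → (∀ w → ∃[ i ] f i ≡ w) →
                (h : Fin n → ℕ) → ⨀ (allFin n) (h ∘ f) ≡ ⨀ (allFin n) h
    ⨀-reindex {f} inj surj h = begin
      ⨀ (allFin n) (h ∘ f)
        ≡⟨ congᵉ (allFin n) (λ i → sym (δ-allFin′ (f i) h)) ⟩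
      ⨀ (allFin n) (λ i → ⨀ (allFin n) (λ w → if ⌊ f i ≟ w ⌋ then h w else ε))
        ≡⟨ ⨀-swap (allFin n) (allFin n) _ ⟩
      ⨀ (allFin n) (λ w → ⨀ (allFin n) (λ i → if ⌊ f i ≟ w ⌋ then h w else ε))
        ≡⟨ congᵉ (allFin n) (λ w → trans (congᵉ (allFin n) (preimage w)) (δ-allFin (proj₁ (surj w)) (λ _ → h w))) ⟩
      ⨀ (allFin n) h ∎
      where
      open ≡-Reasoning
      preimage : ∀ w i → (if ⌊ f i ≟ w ⌋ then h w else ε) ≡ (if ⌊ i ≟ proj₁ (surj w) ⌋ then h w else ε)
      preimage w i with f i ≟ w | i ≟ proj₁ (surj w)
      ... | yes _ | yes _ = refl
      ... | no  _ | no  _ = refl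
      ... | yes p | no  q = ⊥-elim (q (inj (trans p (sym (proj₂ (surj w))))))
      ... | no  p | yes q = ⊥-elim (p (trans (cong f q) (proj₂ (surj w))))

injective⇒surjective : ∀ {n} {f : Fin n → Fin n} → Injective _≡_ _≡_ f → ∀ w → ∃[ i ] f i ≡ w
injective⇒surjective {suc n} {f} inj w with any? (λ i → f i ≟ w)
... | yes p = p
... | no ¬p = ⊥-elim (1+n≰n (injective⇒≤ {f = λ i → punchOut (w≢ i)} (inj ∘ punchOut-injective (w≢ _) (w≢ _))))
  where
  w≢ : ∀ i → w ≢ f i
  w≢ i eq = ¬p (i , sym eq)

open BigOp +-0-isCommutativeMonoid using () renaming
  ( ⨀ to ∑; cong∈ to ∑-cong∈; congᵉ to ∑-cong; ⨀-ε to ∑-0; ⨀-∙ to ∑-+; ⨀-map to ∑-map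
  ; ⨀-concatMap to ∑-concatMap; ⨀-swap to ∑-swap; ⨀-filterB to ∑-filterB
  ; δ-allFin to ∑-δ; δ-allFin′ to ∑-δ′; ⨀-reindex to ∑-reindex) public

open BigOp *-1-isCommutativeMonoid using () renaming
  ( ⨀ to ∏; cong∈ to ∏-cong∈; congᵉ to ∏-cong; ⨀-ε to ∏-1; ⨀-∙ to ∏-*; ⨀-map to ∏-map
  ; ⨀-concatMap to ∏-concatMap; ⨀-swap to ∏-swap; ⨀-filterB to ∏-filterB
  ; δ-allFin to ∏-δ; δ-allFin′ to ∏-δ′; ⨀-reindex to ∏-reindex) public

module _ {A : Set} where

  ∑-mono : {f g : A → ℕ} (xs : List A) → (∀ {x} → x ∈ xs → f x ≤ g x) → ∑ xs f ≤ ∑ xs g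
  ∑-mono []       h = z≤n
  ∑-mono (x ∷ xs) h = +-mono-≤ (h (here refl)) (∑-mono xs (h ∘ there))

  ∑-*ˡ : (c : ℕ) (xs : List A) (f : A → ℕ) → ∑ xs (λ x → c * f x) ≡ c * ∑ xs f
  ∑-*ˡ c []       f = sym (*-zeroʳ c)
  ∑-*ˡ c (x ∷ xs) f = trans (cong (c * f x +_) (∑-*ˡ c xs f)) (sym (*-distribˡ-+ c _ _))

  ∑-*ʳ : (c : ℕ) (xs : List A) (f : A → ℕ) → ∑ xs (λ x → f x * c) ≡ ∑ xs f * c
  ∑-*ʳ c xs f = trans (∑-cong xs (λ x → *-comm (f x) c)) (trans (∑-*ˡ c xs f) (*-comm c _))

  ∑-const : (c : ℕ) (xs : List A) → ∑ xs (λ _ → c) ≡ length xs * c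
  ∑-const c []       = refl
  ∑-const c (x ∷ xs) = cong (c +_) (∑-const c xs)

  ∏-mono : {f g : A → ℕ} (xs : List A) → (∀ {x} → x ∈ xs → f x ≤ g x) → ∏ xs f ≤ ∏ xs g
  ∏-mono []       h = ≤-refl
  ∏-mono (x ∷ xs) h = *-mono-≤ (h (here refl)) (∏-mono xs (h ∘ there))

  ∏-const : (c : ℕ) (xs : List A) → ∏ xs (λ _ → c) ≡ c ^ length xs
  ∏-const c []       = refl
  ∏-const c (x ∷ xs) = cong (c *_) (∏-const c xs)

^-distribʳ-* : ∀ m n o → (m * n) ^ o ≡ m ^ o * n ^ o
^-distribʳ-* m n zero    = refl
^-distribʳ-* m n (suc o) = trans (cong ((m * n) *_) (^-distribʳ-* m n o)) ([m*n]*[o*p]≡[m*o]*[n*p] m n _ _)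

∏-^ : {A : Set} (k : ℕ) (xs : List A) (f : A → ℕ) → ∏ xs (λ x → f x ^ k) ≡ ∏ xs f ^ k
∏-^ k []       f = sym (^-zeroˡ k)
∏-^ k (x ∷ xs) f = trans (cong (f x ^ k *_) (∏-^ k xs f)) (sym (^-distribʳ-* (f x) _ k))

-- Convexity of powers and the AM-GM inequality.

2xy≤x²+y² : ∀ x y → 2 * (x * y) ≤ x * x + y * y
2xy≤x²+y² x y = [ ordered , swapped ]′ (≤-total x y)
  where
  square : ∀ a k → a * a + (a + k) * (a + k) ≡ 2 * (a * (a + k)) + k * k
  square = solve-∀
  ordered : ∀ {a b} → a ≤ b → 2 * (a * b) ≤ a * a + b * b
  ordered {a} a≤b with k , refl ← m≤n⇒∃[o]m+o≡n a≤b =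
    subst (2 * (a * (a + k)) ≤_) (sym (square a k)) (m≤m+n _ (k * k))
  swapped : y ≤ x → 2 * (x * y) ≤ x * x + y * y
  swapped y≤x = subst₂ _≤_ (cong (2 *_) (*-comm y x)) (+-comm (y * y) (x * x)) (ordered y≤x)

-- The convex function yᵐ⁺¹ lies above its tangent at b, with the negative term moved to the right.
tangent-line : ∀ y b m → suc m * (y * b ^ m) ≤ y ^ suc m + m * b ^ suc m
tangent-line y b zero    = ≤-reflexive (cong (_+ 0) (refl {x = y * 1}))
tangent-line y b (suc m) = +-cancelʳ-≤ (m * (y * (b * b ^ m))) _ _ (begin
  suc (suc m) * (y * (b * b ^ m)) + m * (y * (b * b ^ m))
    ≡⟨ lhs m y b (b ^ m) ⟩
  (suc m * b ^ m) * (2 * (y * b))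
    ≤⟨ *-monoʳ-≤ (suc m * b ^ m) (2xy≤x²+y² y b) ⟩
  (suc m * b ^ m) * (y * y + b * b)
    ≡⟨ mid m y b (b ^ m) ⟩
  y * (suc m * (y * b ^ m)) + suc m * (b * (b * b ^ m))
    ≤⟨ +-monoˡ-≤ _ (*-monoʳ-≤ y (tangent-line y b m)) ⟩
  y * (y ^ suc m + m * b ^ suc m) + suc m * (b * (b * b ^ m))
    ≡⟨ rhs m y b (y ^ suc m) (b ^ m) ⟩
  y * y ^ suc m + suc m * (b * (b * b ^ m)) + m * (y * (b * b ^ m)) ∎)
  where
  open ≤-Reasoning
  lhs : ∀ m y b p → suc (suc m) * (y * (b * p)) + m * (y * (b * p)) ≡ (suc m * p) * (2 * (y * b))
  lhs = solve-∀
  mid : ∀ m y b p → (suc m * p) * (y * y + b * b) ≡ y * (suc m * (y * p)) + suc m * (b * (b * p))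
  mid = solve-∀
  rhs : ∀ m y b q p → y * (q + m * (b * p)) + suc m * (b * (b * p)) ≡ y * q + suc m * (b * (b * p)) + m * (y * (b * p))
  rhs = solve-∀

-- This is the tangent of zⁿ⁺¹ at (n+1)A, evaluated at n(A + x). Both points carry the common
-- denominator n(n+1) of the means A/n and (A+x)/(n+1), so nothing is divided.
weighted-AM-GM : ∀ k A x → let n = suc k in suc n ^ suc n * (A ^ n * x) ≤ n ^ n * (A + x) ^ suc n
weighted-AM-GM k A x = *-cancelˡ-≤ n (+-cancelʳ-≤ (n * (suc n * A) ^ suc n) _ _ (begin
  n * (suc n ^ suc n * (A ^ n * x)) + n * (suc n * A) ^ suc n
    ≡⟨ cong (λ z → n * (suc n ^ suc n * (A ^ n * x)) + n * (suc n * A * z)) (^-distribʳ-* (suc n) A n) ⟩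
  n * (suc n ^ suc n * (A ^ n * x)) + n * (suc n * A * (suc n ^ n * A ^ n))
    ≡⟨ lhs n A x (suc n ^ n) (A ^ n) ⟩
  suc n * (n * (A + x) * (suc n ^ n * A ^ n))
    ≡⟨ cong (λ z → suc n * (n * (A + x) * z)) (^-distribʳ-* (suc n) A n) ⟨
  suc n * (n * (A + x) * (suc n * A) ^ n)
    ≤⟨ tangent-line (n * (A + x)) (suc n * A) n ⟩
  (n * (A + x)) ^ suc n + n * (suc n * A) ^ suc n
    ≡⟨ cong (_+ n * (suc n * A) ^ suc n) (trans (^-distribʳ-* n (A + x) (suc n)) (*-assoc n (n ^ n) ((A + x) ^ suc n))) ⟩
  n * (n ^ n * (A + x) ^ suc n) + n * (suc n * A) ^ suc n ∎))
  where
  open ≤-Reasoning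
  n = suc k
  lhs : ∀ n A x p q → n * (suc n * p * (q * x)) + n * (suc n * A * (p * q)) ≡ suc n * (n * (A + x) * (p * q))
  lhs = solve-∀

AM-GM : {A : Set} (xs : List A) (f : A → ℕ) → length xs ^ length xs * ∏ xs f ≤ ∑ xs f ^ length xs
AM-GM []           f = ≤-refl
AM-GM (x ∷ [])     f = ≤-reflexive (one (f x))
  where
  one : ∀ a → 1 * (a * 1) ≡ (a + 0) * 1
  one = solve-∀
AM-GM (x ∷ x′ ∷ xs) f = *-cancelˡ-≤ (n ^ n) ⦃ m^n≢0 n n ⦄ (begin
  n ^ n * (suc n ^ suc n * (f x * P))   ≡⟨ rearrange (n ^ n) (suc n ^ suc n) (f x) P ⟩
  suc n ^ suc n * ((n ^ n * P) * f x)   ≤⟨ *-monoʳ-≤ (suc n ^ suc n) (*-monoˡ-≤ (f x) (AM-GM (x′ ∷ xs) f)) ⟩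
  suc n ^ suc n * (S ^ n * f x)         ≤⟨ weighted-AM-GM (length xs) S (f x) ⟩
  n ^ n * (S + f x) ^ suc n             ≡⟨ cong (λ z → n ^ n * z ^ suc n) (+-comm S (f x)) ⟩
  n ^ n * (f x + S) ^ suc n             ∎)
  where
  open ≤-Reasoning
  n = suc (length xs)
  P = ∏ (x′ ∷ xs) f
  S = ∑ (x′ ∷ xs) f
  rearrange : ∀ a b c d → a * (b * (c * d)) ≡ b * ((a * d) * c)
  rearrange = solve-∀

-- Integer powers and estimates for (d/(d-1))ᵈ.

^-exchange : ∀ m j k → (m ^ j) ^ k ≡ (m ^ k) ^ j
^-exchange m j k = trans (^-*-assoc m j k) (trans (cong (m ^_) (*-comm j k)) (sym (^-*-assoc m k j)))

^-cancelʳ-≤ : ∀ k .⦃ _ : NonZero k ⦄ {a b} → a ^ k ≤ b ^ k → a ≤ b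
^-cancelʳ-≤ k {a} {b} le with a ≤? b
... | yes a≤b = a≤b
... | no  a≰b = contradiction le (<⇒≱ (^-monoˡ-< k (≰⇒> a≰b)))

-- With e = d − 1, c_d = (d / e)ᵈ decreases to Euler's number; d^d / e^d stands for c_d below.
c-decreasing : ∀ k → let e = suc k; d = suc e in suc d ^ suc d * e ^ d ≤ d ^ suc d * d ^ d
c-decreasing k = *-cancelˡ-≤ (d ^ d * d) ⦃ m*n≢0 (d ^ d) d ⦃ m^n≢0 d d ⦄ ⦄ (begin
  d ^ d * d * (suc d ^ suc d * e ^ d)      ≡⟨ lhs (d ^ d) d (suc d ^ suc d) (e ^ d) ⟩
  suc d ^ suc d * (d ^ d * e ^ d * d)      ≡⟨ cong (λ z → suc d ^ suc d * (z * d)) (^-distribʳ-* d e d) ⟨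
  -- AM-GM for d copies of e and one copy of d, whose sum is d².
  suc d ^ suc d * ((d * e) ^ d * d)        ≤⟨ weighted-AM-GM e (d * e) d ⟩
  d ^ d * (d * e + d) ^ suc d              ≡⟨ cong (λ z → d ^ d * z ^ suc d) (trans (+-comm (d * e) d) (sym (*-suc d e))) ⟩
  d ^ d * (d * d) ^ suc d                  ≡⟨ cong (d ^ d *_) (^-distribʳ-* d d (suc d)) ⟩
  d ^ d * (d ^ suc d * (d * d ^ d))        ≡⟨ rhs (d ^ d) (d ^ suc d) d ⟩
  d ^ d * d * (d ^ suc d * d ^ d)          ∎)
  where
  open ≤-Reasoning
  e = suc k
  d = suc e
  lhs : ∀ a d b c → a * d * (b * c) ≡ b * (a * c * d)
  lhs = solve-∀
  rhs : ∀ a b d → a * (b * (d * a)) ≡ a * d * (b * a)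
  rhs = solve-∀

-- The decreasing sequence starts at c_2 = 4.
c≤4 : ∀ k → let e = suc k; d = suc e in d ^ d ≤ 4 * e ^ d
c≤4 zero    = ≤-refl
c≤4 (suc k) = *-cancelʳ-≤ _ _ (e ^ d) ⦃ m^n≢0 e d ⦄ (begin
  suc d ^ suc d * e ^ d       ≤⟨ c-decreasing k ⟩
  d ^ suc d * d ^ d           ≤⟨ *-monoʳ-≤ (d ^ suc d) (c≤4 k) ⟩
  d ^ suc d * (4 * e ^ d)     ≡⟨ rearrange (d ^ suc d) (e ^ d) ⟩
  4 * d ^ suc d * e ^ d       ∎)
  where
  open ≤-Reasoning
  e = suc k
  d = suc e
  rearrange : ∀ a b → a * (4 * b) ≡ 4 * a * b
  rearrange = solve-∀

-- The telescoping product of c_j ≥ c_d over j ≤ d: c_dᵈ⁻¹ (d−1)! ≤ dᵈ.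
factorial-bound : ∀ k → let e = suc k; d = suc e in (d ^ d) ^ e * e ! ≤ d ^ d * (e ^ d) ^ e
factorial-bound zero    = ≤-refl
factorial-bound (suc k) = begin
  a ^ suc e * (suc e * e !)          ≡⟨ lhs a (a ^ e) (suc e) (e !) ⟩
  a * (d * (a ^ e * e !))            ≤⟨ *-monoʳ-≤ a (*-monoʳ-≤ d reduced) ⟩
  a * (d * (p * b ^ e))              ≡⟨ cong (a *_) (sym (*-assoc d p (b ^ e))) ⟩
  a * (b * b ^ e)                    ∎
  where
  open ≤-Reasoning
  e = suc k
  d = suc e
  a = suc d ^ suc d
  b = d ^ suc d
  p = d ^ d
  q = e ^ d
  lhs : ∀ a a′ d f → a * a′ * (d * f) ≡ a * (d * (a′ * f))
  lhs = solve-∀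
  swap-last : ∀ x y z → x * y * z ≡ x * z * y
  swap-last = solve-∀
  reduced : a ^ e * e ! ≤ p * b ^ e
  reduced = *-cancelʳ-≤ _ _ (q ^ e) ⦃ m^n≢0 q e ⦃ m^n≢0 e d ⦄ ⦄ (begin
    a ^ e * e ! * q ^ e      ≡⟨ swap-last (a ^ e) (e !) (q ^ e) ⟩
    a ^ e * q ^ e * e !      ≡⟨ cong (_* e !) (^-distribʳ-* a q e) ⟨
    (a * q) ^ e * e !        ≤⟨ *-monoˡ-≤ (e !) (^-monoˡ-≤ e (c-decreasing k)) ⟩
    (b * p) ^ e * e !        ≡⟨ cong (_* e !) (^-distribʳ-* b p e) ⟩
    b ^ e * p ^ e * e !      ≡⟨ *-assoc (b ^ e) (p ^ e) (e !) ⟩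
    b ^ e * (p ^ e * e !)    ≤⟨ *-monoʳ-≤ (b ^ e) (factorial-bound k) ⟩
    b ^ e * (p * q ^ e)      ≡⟨ trans (sym (*-assoc (b ^ e) p (q ^ e))) (cong (_* q ^ e) (*-comm (b ^ e) p)) ⟩
    p * b ^ e * q ^ e        ∎)

-- The quotient of the upper and the lower bound for one vertex. In (d+1)! the two top factors give
-- (d+1)d ≤ d³. `factorial-bound` uses only d-1 of the d factors c_d, and the remaining one is at
-- most 4 ≤ d². Together this is d⁵.
stirling-gap : ∀ k → let e = suc k; d = suc e in (suc d) ! * (d ^ d) ^ d ≤ d ^ 5 * (d ^ d * (e ^ d) ^ d)
stirling-gap k = begin
  suc d * (d * e !) * (p * p ^ e)     ≡⟨ lhs (suc d) d (e !) p (p ^ e) ⟩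
  suc d * d * p * (p ^ e * e !)       ≤⟨ *-monoʳ-≤ (suc d * d * p) (factorial-bound k) ⟩
  suc d * d * p * (p * q ^ e)         ≤⟨ *-monoʳ-≤ (suc d * d * p) (*-monoˡ-≤ (q ^ e) (≤-trans (c≤4 k) (*-monoˡ-≤ q 4≤d²))) ⟩
  suc d * d * p * (d * d * q * q ^ e) ≤⟨ *-monoˡ-≤ (d * d * q * q ^ e) (*-monoˡ-≤ p (*-monoˡ-≤ d d+1≤d²)) ⟩
  d * d * d * p * (d * d * q * q ^ e) ≡⟨ rhs d p q (q ^ e) ⟩
  d ^ 5 * (p * (q * q ^ e))           ∎
  where
  open ≤-Reasoning
  e = suc k
  d = suc e
  p = d ^ d
  q = e ^ d
  4≤d² : 4 ≤ d * d
  4≤d² = *-mono-≤ (s≤s (s≤s (z≤n {k}))) (s≤s (s≤s (z≤n {k})))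
  d+1≤d² : suc d ≤ d * d
  d+1≤d² = subst (suc d ≤_) (sym (square k)) (m≤m+n (suc d) _)
    where
    square : ∀ k → (2 + k) * (2 + k) ≡ 3 + k + (1 + 3 * k + k * k)
    square = solve-∀
  lhs : ∀ c d f p r → c * (d * f) * (p * r) ≡ c * d * p * (r * f)
  lhs = solve-∀
  rhs : ∀ d p q r → d * d * d * p * (d * d * q * r) ≡ d * (d * (d * (d * (d * 1)))) * (p * (q * r))
  rhs = solve-∀

-- Deleting a row from a set of rows.

_∖_ : ∀ {n} → (Fin n → Bool) → Fin n → (Fin n → Bool)
(R ∖ r) s = R s ∧ not ⌊ s ≟ r ⌋

full : ∀ {n} → Fin n → Bool
full _ = true

module _ {n : ℕ} where

  ∖-cong : {R S : Fin n → Bool} → (∀ r → R r ≡ S r) → ∀ s r → (R ∖ s) r ≡ (S ∖ s) r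
  ∖-cong h s r = cong (_∧ not ⌊ r ≟ s ⌋) (h r)

  ∖-comm : (R : Fin n → Bool) (r s t : Fin n) → ((R ∖ r) ∖ s) t ≡ ((R ∖ s) ∖ r) t
  ∖-comm R r s t with R t | t ≟ r | t ≟ s
  ... | false | _     | _     = refl
  ... | true  | yes _ | yes _ = refl
  ... | true  | yes _ | no  _ = refl
  ... | true  | no  _ | yes _ = refl
  ... | true  | no  _ | no  _ = refl

  ∖-true-sym : (R : Fin n → Bool) (r s : Fin n) → R r ≡ true → (R ∖ r) s ≡ true → (R ∖ s) r ≡ true
  ∖-true-sym R r s Rr eq with R s | s ≟ r | r ≟ s
  ... | true | no  _   | no _    = trans (cong (_∧ true) Rr) refl
  ... | true | no  s≢r | yes r≡s = ⊥-elim (s≢r (sym r≡s))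
  ∖-true-sym R r s Rr () | true  | yes _ | _
  ∖-true-sym R r s Rr () | false | _     | _

  𝟙-∖-sym : (R : Fin n → Bool) (s t : Fin n) → 𝟙 (R s) * 𝟙 ((R ∖ s) t) ≡ 𝟙 (R t) * 𝟙 ((R ∖ t) s)
  𝟙-∖-sym R s t with R s in eqs | R t in eqt | s ≟ t | t ≟ s
  ... | true  | true  | yes _ | yes _ = refl
  ... | true  | true  | no  _ | no  _ = refl
  ... | true  | true  | yes p | no  q = ⊥-elim (q (sym p))
  ... | true  | true  | no  p | yes q = ⊥-elim (p (sym q))
  ... | true  | false | _     | _     = refl
  ... | false | true  | _     | _     = refl
  ... | false | false | _     | _     = refl

  ∑-remove : (R : Fin n → Bool) (r : Fin n) → R r ≡ true → (f : Fin n → ℕ) →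
             ∑ (allFin n) (λ s → 𝟙 (R s) * f s) ≡ f r + ∑ (allFin n) (λ s → 𝟙 ((R ∖ r) s) * f s)
  ∑-remove R r Rr f = begin
    ∑ (allFin n) (λ s → 𝟙 (R s) * f s)
      ≡⟨ ∑-cong (allFin n) split ⟩
    ∑ (allFin n) (λ s → (if ⌊ s ≟ r ⌋ then f s else 0) + 𝟙 ((R ∖ r) s) * f s)
      ≡⟨ ∑-+ (allFin n) (λ s → if ⌊ s ≟ r ⌋ then f s else 0) (λ s → 𝟙 ((R ∖ r) s) * f s) ⟩
    ∑ (allFin n) (λ s → if ⌊ s ≟ r ⌋ then f s else 0) + ∑ (allFin n) (λ s → 𝟙 ((R ∖ r) s) * f s)
      ≡⟨ cong (_+ ∑ (allFin n) (λ s → 𝟙 ((R ∖ r) s) * f s)) (∑-δ r f) ⟩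
    f r + ∑ (allFin n) (λ s → 𝟙 ((R ∖ r) s) * f s) ∎
    where
    open ≡-Reasoning
    split : ∀ s → 𝟙 (R s) * f s ≡ (if ⌊ s ≟ r ⌋ then f s else 0) + 𝟙 ((R ∖ r) s) * f s
    split s with s ≟ r | R s in eq
    ... | yes refl | true  = cong (_+ 0) (refl {x = f s})
    ... | yes refl | false with () ← trans (sym eq) Rr
    ... | no _     | true  = refl
    ... | no _     | false = refl

  ∏-remove : (R : Fin n → Bool) (r : Fin n) → R r ≡ true → (v : Fin n → ℕ) →
             ∏ (allFin n) (λ s → if R s then v s else 1) ≡ v r * ∏ (allFin n) (λ s → if (R ∖ r) s then v s else 1)
  ∏-remove R r Rr v = begin
    ∏ (allFin n) (λ s → if R s then v s else 1)
      ≡⟨ ∏-cong (allFin n) split ⟩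
    ∏ (allFin n) (λ s → (if ⌊ s ≟ r ⌋ then v s else 1) * (if (R ∖ r) s then v s else 1))
      ≡⟨ ∏-* (allFin n) (λ s → if ⌊ s ≟ r ⌋ then v s else 1) (λ s → if (R ∖ r) s then v s else 1) ⟩
    ∏ (allFin n) (λ s → if ⌊ s ≟ r ⌋ then v s else 1) * ∏ (allFin n) (λ s → if (R ∖ r) s then v s else 1)
      ≡⟨ cong (_* ∏ (allFin n) (λ s → if (R ∖ r) s then v s else 1)) (∏-δ r v) ⟩
    v r * ∏ (allFin n) (λ s → if (R ∖ r) s then v s else 1) ∎
    where
    open ≡-Reasoning
    split : ∀ s → (if R s then v s else 1) ≡ (if ⌊ s ≟ r ⌋ then v s else 1) * (if (R ∖ r) s then v s else 1)
    split s with s ≟ r | R s in eq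
    ... | yes refl | true  = sym (*-identityʳ (v s))
    ... | yes refl | false with () ← trans (sym eq) Rr
    ... | no _     | true  = sym (+-identityʳ (v s))
    ... | no _     | false = refl

𝟙*-mono : (b : Bool) {x y : ℕ} → (b ≡ true → x ≤ y) → 𝟙 b * x ≤ 𝟙 b * y
𝟙*-mono false h = z≤n
𝟙*-mono true  h = +-monoˡ-≤ 0 (h refl)

𝟙*-cong : (b : Bool) {x y : ℕ} → (b ≡ true → x ≡ y) → 𝟙 b * x ≡ 𝟙 b * y
𝟙*-cong false h = refl
𝟙*-cong true  h = cong (_+ 0) (h refl)

-- Weighted matchings of columns to rows, and their log-concavity.

select : {A : Set} → List A → List (A × List A)
select []       = []
select (x ∷ xs) = (x , xs) ∷ map (λ (y , ys) → y , x ∷ ys) (select xs)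

select-↭ : {A : Set} (xs : List A) {y : A} {ys : List A} → (y , ys) ∈ select xs → xs ↭ y ∷ ys
select-↭ (x ∷ xs) (here refl) = ↭-refl
select-↭ (x ∷ xs) (there y∈) with ∈-map⁻ (λ (y , ys) → y , x ∷ ys) y∈
... | (y , ys) , y∈xs , refl = ↭-trans (↭-prep x (select-↭ xs y∈xs)) (↭-swap x y ↭-refl)

-- Φ v R C is the weighted number of ways to match every column of C to its own row of R,
-- where each row r of R left unmatched contributes a factor v r.
module Matching {n : ℕ} (a : Fin n → Fin n → ℕ) where

  Φ : (Fin n → ℕ) → (Fin n → Bool) → List (Fin n) → ℕ
  Φ v R []      = ∏ (allFin n) (λ r → if R r then v r else 1)
  Φ v R (c ∷ C) = ∑ (allFin n) (λ r → 𝟙 (R r) * (a r c * Φ v (R ∖ r) C))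

  Φ-cong : ∀ {v w R S} → (∀ r → v r ≡ w r) → (∀ r → R r ≡ S r) → ∀ C → Φ v R C ≡ Φ w S C
  Φ-cong v≗w R≗S []      = ∏-cong (allFin n) (λ r → cong₂ (λ b x → if b then x else 1) (R≗S r) (v≗w r))
  Φ-cong v≗w R≗S (c ∷ C) = ∑-cong (allFin n) (λ r →
    cong₂ (λ b x → 𝟙 b * (a r c * x)) (R≗S r) (Φ-cong v≗w (∖-cong R≗S r) C))

  Φ-mono : ∀ {v w} → (∀ r → v r ≤ w r) → ∀ R C → Φ v R C ≤ Φ w R C
  Φ-mono v≤w R [] = ∏-mono (allFin n) (λ {r} _ → branch r)
    where
    branch : ∀ r → (if R r then _ else 1) ≤ (if R r then _ else 1)
    branch r with R r
    ... | true  = v≤w r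
    ... | false = ≤-refl
  Φ-mono v≤w R (c ∷ C) = ∑-mono (allFin n) (λ {r} _ →
    *-monoʳ-≤ (𝟙 (R r)) (*-monoʳ-≤ (a r c) (Φ-mono v≤w (R ∖ r) C)))

  Φ-swap : ∀ v R c c′ C → Φ v R (c ∷ c′ ∷ C) ≡ Φ v R (c′ ∷ c ∷ C)
  Φ-swap v R c c′ C = begin
    Φ v R (c ∷ c′ ∷ C)
      ≡⟨ expand c c′ ⟩
    ∑ (allFin n) (λ s → ∑ (allFin n) (λ t → term c c′ s t))
      ≡⟨ ∑-swap (allFin n) (allFin n) (term c c′) ⟩
    ∑ (allFin n) (λ t → ∑ (allFin n) (λ s → term c c′ s t))
      ≡⟨ ∑-cong (allFin n) (λ t → ∑-cong (allFin n) (λ s → symmetric s t)) ⟩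
    ∑ (allFin n) (λ t → ∑ (allFin n) (λ s → term c′ c t s))
      ≡⟨ expand c′ c ⟨
    Φ v R (c′ ∷ c ∷ C) ∎
    where
    open ≡-Reasoning
    term : Fin n → Fin n → Fin n → Fin n → ℕ
    term c c′ s t = 𝟙 (R s) * 𝟙 ((R ∖ s) t) * (a s c * a t c′ * Φ v ((R ∖ s) ∖ t) C)
    assoc₅ : ∀ x y z p q → x * (y * (z * (p * q))) ≡ x * z * (y * p * q)
    assoc₅ = solve-∀
    expand : ∀ c c′ → Φ v R (c ∷ c′ ∷ C) ≡ ∑ (allFin n) (λ s → ∑ (allFin n) (λ t → term c c′ s t))
    expand c c′ = ∑-cong (allFin n) (λ s → sym (begin
      ∑ (allFin n) (λ t → term c c′ s t)
        ≡⟨ ∑-cong (allFin n) (λ t → sym (assoc₅ (𝟙 (R s)) (a s c) _ (a t c′) _)) ⟩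
      ∑ (allFin n) (λ t → 𝟙 (R s) * (a s c * (𝟙 ((R ∖ s) t) * (a t c′ * Φ v ((R ∖ s) ∖ t) C))))
        ≡⟨ ∑-*ˡ (𝟙 (R s)) (allFin n) _ ⟩
      𝟙 (R s) * ∑ (allFin n) (λ t → a s c * (𝟙 ((R ∖ s) t) * (a t c′ * Φ v ((R ∖ s) ∖ t) C)))
        ≡⟨ cong (𝟙 (R s) *_) (∑-*ˡ (a s c) (allFin n) _) ⟩
      𝟙 (R s) * (a s c * Φ v (R ∖ s) (c′ ∷ C)) ∎))
    symmetric : ∀ s t → term c c′ s t ≡ term c′ c t s
    symmetric s t = cong₂ _*_ (𝟙-∖-sym R s t)
      (cong₂ _*_ (*-comm (a s c) (a t c′)) (Φ-cong (λ _ → refl) (∖-comm R s t) C))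

  Φ-↭ : ∀ v R {C D} → C ↭ D → Φ v R C ≡ Φ v R D
  Φ-↭ v R ↭-refl           = refl
  Φ-↭ v R (↭-prep c p)     = ∑-cong (allFin n) (λ r → cong (λ x → 𝟙 (R r) * (a r c * x)) (Φ-↭ v (R ∖ r) p))
  Φ-↭ v R (↭-swap {C} {D} c c′ p) = trans (Φ-swap v R c c′ C) (Φ-↭₂ p)
    where
    Φ-↭₂ : C ↭ D → Φ v R (c′ ∷ c ∷ C) ≡ Φ v R (c′ ∷ c ∷ D)
    Φ-↭₂ p = ∑-cong (allFin n) (λ r → cong (λ x → 𝟙 (R r) * (a r c′ * x))
             (∑-cong (allFin n) (λ s → cong (λ x → 𝟙 ((R ∖ r) s) * (a s c * x)) (Φ-↭ v ((R ∖ r) ∖ s) p))))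
  Φ-↭ v R (↭-trans p q)    = trans (Φ-↭ v R p) (Φ-↭ v R q)

  -- Sorts the matchings by the fate of r: unmatched, or matched to one column of C. As Φ is defined
  -- by expansion along columns, the induction expands the first column and uses that the two row
  -- deletions commute.
  row-expansion : ∀ v R r C → R r ≡ true →
    Φ v R C ≡ v r * Φ v (R ∖ r) C + ∑ (select C) (λ (c , C′) → a r c * Φ v (R ∖ r) C′)
  row-expansion v R r []      Rr = trans (∏-remove R r Rr v) (sym (+-identityʳ _))
  row-expansion v R r (c ∷ C) Rr = begin
    Φ v R (c ∷ C)
      ≡⟨ ∑-remove R r Rr (λ s → a s c * Φ v (R ∖ s) C) ⟩
    a r c * Φ v (R ∖ r) C + ∑ (allFin n) (λ s → 𝟙 ((R ∖ r) s) * (a s c * Φ v (R ∖ s) C))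
      ≡⟨ cong (a r c * Φ v (R ∖ r) C +_) (∑-cong (allFin n) inner) ⟩
    a r c * Φ v (R ∖ r) C + ∑ (allFin n) (λ s → v r * rest s C + ∑ (select C) (λ (c′ , C′) → a r c′ * rest s C′))
      ≡⟨ cong (a r c * Φ v (R ∖ r) C +_) collect ⟩
    a r c * Φ v (R ∖ r) C + (v r * Φ v (R ∖ r) (c ∷ C) + ∑ (select C) (λ (c′ , C′) → a r c′ * Φ v (R ∖ r) (c ∷ C′)))
      ≡⟨ shuffle (a r c * Φ v (R ∖ r) C) (v r * Φ v (R ∖ r) (c ∷ C)) _ ⟩
    v r * Φ v (R ∖ r) (c ∷ C) + (a r c * Φ v (R ∖ r) C + ∑ (select C) (λ (c′ , C′) → a r c′ * Φ v (R ∖ r) (c ∷ C′)))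
      ≡⟨ cong (λ z → v r * Φ v (R ∖ r) (c ∷ C) + (a r c * Φ v (R ∖ r) C + z)) (sym (∑-map _ (select C) _)) ⟩
    v r * Φ v (R ∖ r) (c ∷ C) + ∑ (select (c ∷ C)) (λ (c′ , C′) → a r c′ * Φ v (R ∖ r) C′) ∎
    where
    open ≡-Reasoning
    rest : Fin n → List (Fin n) → ℕ
    rest s C′ = 𝟙 ((R ∖ r) s) * (a s c * Φ v ((R ∖ r) ∖ s) C′)
    shuffle : ∀ x y z → x + (y + z) ≡ y + (x + z)
    shuffle = solve-∀
    pull : ∀ b x y z → b * (x * (y * z)) ≡ y * (b * (x * z))
    pull = solve-∀
    inner : ∀ s → 𝟙 ((R ∖ r) s) * (a s c * Φ v (R ∖ s) C)
                ≡ v r * rest s C + ∑ (select C) (λ (c′ , C′) → a r c′ * rest s C′)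
    inner s = begin
      b * (a s c * Φ v (R ∖ s) C)
        ≡⟨ 𝟙*-cong ((R ∖ r) s) (λ Rs → cong (a s c *_) (row-expansion v (R ∖ s) r C (∖-true-sym R r s Rr Rs))) ⟩
      b * (a s c * (v r * Φ v ((R ∖ s) ∖ r) C + ∑ (select C) (λ (c′ , C′) → a r c′ * Φ v ((R ∖ s) ∖ r) C′)))
        ≡⟨ cong (λ z → b * (a s c * z)) (cong₂ _+_ (cong (v r *_) (commute C)) (∑-cong (select C) (λ (c′ , C′) → cong (a r c′ *_) (commute C′)))) ⟩
      b * (a s c * (v r * Φ v ((R ∖ r) ∖ s) C + ∑ (select C) (λ (c′ , C′) → a r c′ * Φ v ((R ∖ r) ∖ s) C′)))
        ≡⟨ trans (cong (b *_) (*-distribˡ-+ (a s c) _ _)) (*-distribˡ-+ b _ _) ⟩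
      b * (a s c * (v r * Φ v ((R ∖ r) ∖ s) C)) + b * (a s c * ∑ (select C) (λ (c′ , C′) → a r c′ * Φ v ((R ∖ r) ∖ s) C′))
        ≡⟨ cong₂ _+_ (pull b (a s c) (v r) _) distribute ⟩
      v r * rest s C + ∑ (select C) (λ (c′ , C′) → a r c′ * rest s C′) ∎
      where
      b = 𝟙 ((R ∖ r) s)
      commute : ∀ C′ → Φ v ((R ∖ s) ∖ r) C′ ≡ Φ v ((R ∖ r) ∖ s) C′
      commute = Φ-cong (λ _ → refl) (∖-comm R s r)
      distribute : b * (a s c * ∑ (select C) (λ (c′ , C′) → a r c′ * Φ v ((R ∖ r) ∖ s) C′))
                 ≡ ∑ (select C) (λ (c′ , C′) → a r c′ * rest s C′)
      distribute = begin
        b * (a s c * ∑ (select C) (λ (c′ , C′) → a r c′ * Φ v ((R ∖ r) ∖ s) C′))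
          ≡⟨ *-assoc b (a s c) _ ⟨
        b * a s c * ∑ (select C) (λ (c′ , C′) → a r c′ * Φ v ((R ∖ r) ∖ s) C′)
          ≡⟨ ∑-*ˡ (b * a s c) (select C) _ ⟨
        ∑ (select C) (λ (c′ , C′) → b * a s c * (a r c′ * Φ v ((R ∖ r) ∖ s) C′))
          ≡⟨ ∑-cong (select C) (λ (c′ , C′) → trans (*-assoc b (a s c) _) (pull b (a s c) (a r c′) _)) ⟩
        ∑ (select C) (λ (c′ , C′) → a r c′ * rest s C′) ∎
    collect : ∑ (allFin n) (λ s → v r * rest s C + ∑ (select C) (λ (c′ , C′) → a r c′ * rest s C′))
            ≡ v r * Φ v (R ∖ r) (c ∷ C) + ∑ (select C) (λ (c′ , C′) → a r c′ * Φ v (R ∖ r) (c ∷ C′))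
    collect = trans (∑-+ (allFin n) _ _) (cong₂ _+_ (∑-*ˡ (v r) (allFin n) _)
      (trans (∑-swap (allFin n) (select C) _) (∑-cong (select C) (λ (c′ , C′) → ∑-*ˡ (a r c′) (allFin n) _))))

  -- Unfolded into a continued fraction with nonnegative coefficients, Φ v R (u ∷ C) / Φ v R C is
  -- an alternation of order-reversing maps; hence it is antitone in v, and Φ v R C / Φ v (R ∖ r) C
  -- is monotone in v.
  module _ {v w : Fin n → ℕ} (v≤w : ∀ r → v r ≤ w r) where

    row-ratio-mono : ∀ k R r C → length C ≡ k → R r ≡ true →
                     Φ v R C * Φ w (R ∖ r) C ≤ Φ w R C * Φ v (R ∖ r) C
    column-ratio-anti : ∀ k R u C → length C ≡ k →
                        Φ w R (u ∷ C) * Φ v R C ≤ Φ v R (u ∷ C) * Φ w R C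

    row-ratio-mono k R r C len Rr = begin
      Φ v R C * W
        ≡⟨ cong (_* W) (row-expansion v R r C Rr) ⟩
      (v r * V + ∑ (select C) (λ (c , C′) → a r c * Φ v (R ∖ r) C′)) * W
        ≡⟨ distribute (v r) V W _ ⟩
      v r * (V * W) + ∑ (select C) (λ (c , C′) → a r c * Φ v (R ∖ r) C′) * W
        ≤⟨ +-mono-≤ (*-monoˡ-≤ (V * W) (v≤w r)) columns ⟩
      w r * (V * W) + ∑ (select C) (λ (c , C′) → a r c * Φ w (R ∖ r) C′) * V
        ≡⟨ trans (distribute (w r) W V _) (cong (λ z → w r * z + ∑ (select C) (λ (c , C′) → a r c * Φ w (R ∖ r) C′) * V) (*-comm W V)) ⟨
      (w r * W + ∑ (select C) (λ (c , C′) → a r c * Φ w (R ∖ r) C′)) * V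
        ≡⟨ cong (_* V) (row-expansion w R r C Rr) ⟨
      Φ w R C * V ∎
      where
      open ≤-Reasoning
      V = Φ v (R ∖ r) C
      W = Φ w (R ∖ r) C
      distribute : ∀ x y z t → (x * y + t) * z ≡ x * (y * z) + t * z
      distribute = solve-∀
      -- C is a permutation of `c ∷ C′`, so this ratio is the reciprocal of a column ratio with one
      -- column fewer. `C′` is no structural part of C, hence the recursion runs on the length k.
      one-column : ∀ k → length C ≡ k → ∀ {c C′} → (c , C′) ∈ select C →
                   Φ v (R ∖ r) C′ * W ≤ Φ w (R ∖ r) C′ * V
      one-column k len {c} {C′} c∈ with k | trans (sym (↭-length (select-↭ C c∈))) len
      ... | suc k | len′ = begin
        Φ v (R ∖ r) C′ * W                     ≡⟨ cong (Φ v (R ∖ r) C′ *_) (Φ-↭ w (R ∖ r) (select-↭ C c∈)) ⟩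
        Φ v (R ∖ r) C′ * Φ w (R ∖ r) (c ∷ C′)  ≡⟨ *-comm (Φ v (R ∖ r) C′) _ ⟩
        Φ w (R ∖ r) (c ∷ C′) * Φ v (R ∖ r) C′  ≤⟨ column-ratio-anti k (R ∖ r) c C′ (suc-injective len′) ⟩
        Φ v (R ∖ r) (c ∷ C′) * Φ w (R ∖ r) C′  ≡⟨ *-comm _ (Φ w (R ∖ r) C′) ⟩
        Φ w (R ∖ r) C′ * Φ v (R ∖ r) (c ∷ C′)  ≡⟨ cong (Φ w (R ∖ r) C′ *_) (Φ-↭ v (R ∖ r) (select-↭ C c∈)) ⟨
        Φ w (R ∖ r) C′ * V                     ∎
      columns : ∑ (select C) (λ (c , C′) → a r c * Φ v (R ∖ r) C′) * W
              ≤ ∑ (select C) (λ (c , C′) → a r c * Φ w (R ∖ r) C′) * V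
      columns = begin
        ∑ (select C) (λ (c , C′) → a r c * Φ v (R ∖ r) C′) * W
          ≡⟨ ∑-*ʳ W (select C) _ ⟨
        ∑ (select C) (λ (c , C′) → a r c * Φ v (R ∖ r) C′ * W)
          ≤⟨ ∑-mono (select C) (λ {(c , C′)} c∈ → subst₂ _≤_ (sym (*-assoc (a r c) _ W)) (sym (*-assoc (a r c) _ V))
               (*-monoʳ-≤ (a r c) (one-column k len c∈))) ⟩
        ∑ (select C) (λ (c , C′) → a r c * Φ w (R ∖ r) C′ * V)
          ≡⟨ ∑-*ʳ V (select C) _ ⟩
        ∑ (select C) (λ (c , C′) → a r c * Φ w (R ∖ r) C′) * V ∎

    column-ratio-anti k R u C len = begin
      Φ w R (u ∷ C) * Φ v R C
        ≡⟨ ∑-*ʳ (Φ v R C) (allFin n) _ ⟨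
      ∑ (allFin n) (λ r → 𝟙 (R r) * (a r u * Φ w (R ∖ r) C) * Φ v R C)
        ≤⟨ ∑-mono (allFin n) (λ {r} _ → one-row r) ⟩
      ∑ (allFin n) (λ r → 𝟙 (R r) * (a r u * Φ v (R ∖ r) C) * Φ w R C)
        ≡⟨ ∑-*ʳ (Φ w R C) (allFin n) _ ⟩
      Φ v R (u ∷ C) * Φ w R C ∎
      where
      open ≤-Reasoning
      regroup : ∀ b x y z → b * (x * y) * z ≡ b * (x * (z * y))
      regroup = solve-∀
      one-row : ∀ r → 𝟙 (R r) * (a r u * Φ w (R ∖ r) C) * Φ v R C ≤ 𝟙 (R r) * (a r u * Φ v (R ∖ r) C) * Φ w R C
      one-row r = subst₂ _≤_ (sym (regroup (𝟙 (R r)) (a r u) _ _)) (sym (regroup (𝟙 (R r)) (a r u) _ _))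
        (𝟙*-mono (R r) (λ Rr → *-monoʳ-≤ (a r u) (row-ratio-mono k R r C len Rr)))

-- Growth of Φ along a ray.

∏-if : {A : Set} (xs : List A) (p : A → Bool) (c : ℕ) →
       ∏ xs (λ x → if p x then c else 1) ≡ c ^ ∑ xs (λ x → 𝟙 (p x))
∏-if []       p c = refl
∏-if (x ∷ xs) p c with p x
... | true  = cong (c *_) (∏-if xs p c)
... | false = trans (+-identityʳ _) (∏-if xs p c)

length-∑ : {A : Set} (xs : List A) → length xs ≡ ∑ xs (λ _ → 1)
length-∑ xs = sym (trans (∑-const 1 xs) (*-identityʳ _))

length-allFin : ∀ n → length (allFin n) ≡ n
length-allFin n = length-tabulate id

-- A product of nonnegative factors has increasing partial derivatives, so its increment from f to h
-- is at most the first-order term taken at the upper end h. Splitting the first factor into f + g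
-- gives the induction.
∏-increment : ∀ {n} {xs : List (Fin n)} → Unique xs → (f g h : Fin n → ℕ) → (∀ x → h x ≡ f x + g x) →
              ∏ xs h ≤ ∏ xs f + ∑ xs (λ x → g x * ∏ xs (λ y → if ⌊ y ≟ x ⌋ then 1 else h y))
∏-increment {xs = []} [] f g h h≡ = ≤-refl
∏-increment {xs = x ∷ xs} (x∉xs ∷ uniq) f g h h≡ = begin
  h x * ∏ xs h
    ≡⟨ trans (cong (_* ∏ xs h) (h≡ x)) (*-distribʳ-+ (∏ xs h) (f x) (g x)) ⟩
  f x * ∏ xs h + g x * ∏ xs h
    ≤⟨ +-monoˡ-≤ (g x * ∏ xs h) (*-monoʳ-≤ (f x) (∏-increment uniq f g h h≡)) ⟩
  f x * (∏ xs f + ∑ xs (λ y → g y * others y)) + g x * ∏ xs h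
    ≡⟨ trans (cong (_+ g x * ∏ xs h) (*-distribˡ-+ (f x) (∏ xs f) _)) (regroup (f x * ∏ xs f) _ _) ⟩
  f x * ∏ xs f + (g x * ∏ xs h + f x * ∑ xs (λ y → g y * others y))
    ≤⟨ +-monoʳ-≤ (f x * ∏ xs f) (+-mono-≤ (≤-reflexive (cong (g x *_) head)) tail) ⟩
  f x * ∏ xs f + (g x * ∏ (x ∷ xs) (except x) + ∑ xs (λ y → g y * ∏ (x ∷ xs) (except y))) ∎
  where
  open ≤-Reasoning
  except : _ → _ → ℕ
  except x y = if ⌊ y ≟ x ⌋ then 1 else h y
  others : _ → ℕ
  others y = ∏ xs (except y)
  regroup : ∀ a b c → a + b + c ≡ a + (c + b)
  regroup = solve-∀
  except-≢ : ∀ {x y} → y ≢ x → except x y ≡ h y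
  except-≢ {x} {y} y≢x with y ≟ x
  ... | yes p = ⊥-elim (y≢x p)
  ... | no  _ = refl
  head : ∏ xs h ≡ except x x * ∏ xs (except x)
  head with x ≟ x
  ... | yes _ = trans (∏-cong∈ xs (λ y∈ → sym (except-≢ (λ y≡x → All.lookup x∉xs y∈ (sym y≡x))))) (sym (+-identityʳ _))
  ... | no  x≢x = ⊥-elim (x≢x refl)
  tail : f x * ∑ xs (λ y → g y * others y) ≤ ∑ xs (λ y → g y * (except y x * others y))
  tail = subst (_≤ ∑ xs (λ y → g y * (except y x * others y))) (∑-*ˡ (f x) xs _) (∑-mono xs (λ {y} y∈ → begin
    f x * (g y * others y)          ≤⟨ *-monoˡ-≤ (g y * others y) (≤-trans (m≤m+n (f x) (g x)) (≤-reflexive (sym (h≡ x)))) ⟩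
    h x * (g y * others y)          ≡⟨ cong (_* (g y * others y)) (except-≢ (All.lookup x∉xs y∈)) ⟨
    except y x * (g y * others y)   ≡⟨ swap₃ (except y x) (g y) (others y) ⟩
    g y * (except y x * others y)   ∎))
    where
    swap₃ : ∀ a b c → a * (b * c) ≡ b * (a * c)
    swap₃ = solve-∀

module Homogeneity {n : ℕ} (a : Fin n → Fin n → ℕ) where
  open Matching a

  count-remove : (R : Fin n → Bool) (r : Fin n) → R r ≡ true →
                 ∑ (allFin n) (λ s → 𝟙 (R s)) ≡ suc (∑ (allFin n) (λ s → 𝟙 ((R ∖ r) s)))
  count-remove R r Rr = begin
    ∑ (allFin n) (λ s → 𝟙 (R s))                  ≡⟨ ∑-cong (allFin n) (λ s → *-identityʳ (𝟙 (R s))) ⟨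
    ∑ (allFin n) (λ s → 𝟙 (R s) * 1)              ≡⟨ ∑-remove R r Rr (λ _ → 1) ⟩
    suc (∑ (allFin n) (λ s → 𝟙 ((R ∖ r) s) * 1))  ≡⟨ cong suc (∑-cong (allFin n) (λ s → *-identityʳ (𝟙 ((R ∖ r) s)))) ⟩
    suc (∑ (allFin n) (λ s → 𝟙 ((R ∖ r) s)))      ∎
    where open ≡-Reasoning

  -- Every matching of the columns of C leaves exactly m rows of R unmatched.
  Φ-homogeneous : ∀ l v R C m → ∑ (allFin n) (λ r → 𝟙 (R r)) ≡ length C + m →
                  Φ (λ r → l * v r) R C ≡ l ^ m * Φ v R C
  Φ-homogeneous l v R [] m count = begin
    ∏ (allFin n) (λ r → if R r then l * v r else 1)
      ≡⟨ ∏-cong (allFin n) split ⟩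
    ∏ (allFin n) (λ r → (if R r then l else 1) * (if R r then v r else 1))
      ≡⟨ ∏-* (allFin n) (λ r → if R r then l else 1) (λ r → if R r then v r else 1) ⟩
    ∏ (allFin n) (λ r → if R r then l else 1) * Φ v R []
      ≡⟨ cong (_* Φ v R []) (trans (∏-if (allFin n) R l) (cong (l ^_) count)) ⟩
    l ^ m * Φ v R [] ∎
    where
    open ≡-Reasoning
    split : ∀ r → (if R r then l * v r else 1) ≡ (if R r then l else 1) * (if R r then v r else 1)
    split r with R r
    ... | true  = refl
    ... | false = refl
  Φ-homogeneous l v R (c ∷ C) m count = begin
    ∑ (allFin n) (λ r → 𝟙 (R r) * (a r c * Φ (λ r → l * v r) (R ∖ r) C))
      ≡⟨ ∑-cong (allFin n) (λ r → trans (𝟙*-cong (R r) (λ Rr → cong (a r c *_)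
           (Φ-homogeneous l v (R ∖ r) C m (suc-injective (trans (sym (count-remove R r Rr)) count))))) (pull (𝟙 (R r)) (a r c) (l ^ m) _)) ⟩
    ∑ (allFin n) (λ r → l ^ m * (𝟙 (R r) * (a r c * Φ v (R ∖ r) C)))
      ≡⟨ ∑-*ˡ (l ^ m) (allFin n) _ ⟩
    l ^ m * Φ v R (c ∷ C) ∎
    where
    open ≡-Reasoning
    pull : ∀ b x y z → b * (x * (y * z)) ≡ y * (b * (x * z))
    pull = solve-∀

  -- Φ w R (u ∷ C) is the derivative of Φ at w in the direction of the column u, and Φ is convex along
  -- that direction.
  Φ-increment : ∀ {v w} s u → (∀ r → w r ≡ v r + s * a r u) → ∀ R C →
                Φ w R C ≤ Φ v R C + s * Φ w R (u ∷ C)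
  Φ-increment {v} {w} s u w≡ R [] = begin
    ∏ (allFin n) h
      ≤⟨ ∏-increment (allFin⁺ n) f g h h≡ ⟩
    ∏ (allFin n) f + ∑ (allFin n) (λ r → g r * ∏ (allFin n) (λ y → if ⌊ y ≟ r ⌋ then 1 else h y))
      ≡⟨ cong (∏ (allFin n) f +_) (trans (∑-cong (allFin n) summand) (∑-*ˡ s (allFin n) _)) ⟩
    Φ v R [] + s * Φ w R (u ∷ []) ∎
    where
    open ≤-Reasoning
    f g h : Fin n → ℕ
    f r = if R r then v r else 1
    g r = if R r then s * a r u else 0
    h r = if R r then w r else 1
    h≡ : ∀ r → h r ≡ f r + g r
    h≡ r with R r
    ... | true  = w≡ r
    ... | false = refl
    merge : ∀ r y → (if ⌊ y ≟ r ⌋ then 1 else h y) ≡ (if (R ∖ r) y then w y else 1)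
    merge r y with R y | y ≟ r
    ... | true  | yes _ = refl
    ... | true  | no  _ = refl
    ... | false | yes _ = refl
    ... | false | no  _ = refl
    summand : ∀ r → g r * ∏ (allFin n) (λ y → if ⌊ y ≟ r ⌋ then 1 else h y) ≡ s * (𝟙 (R r) * (a r u * Φ w (R ∖ r) []))
    summand r with R r
    ... | true  = trans (cong (s * a r u *_) (∏-cong (allFin n) (merge r))) (regroup s (a r u) (Φ w (R ∖ r) []))
      where
      regroup : ∀ x y z → x * y * z ≡ x * (1 * (y * z))
      regroup = solve-∀
    ... | false = sym (*-zeroʳ s)
  Φ-increment {v} {w} s u w≡ R (c ∷ C) = begin
    ∑ (allFin n) (λ r → 𝟙 (R r) * (a r c * Φ w (R ∖ r) C))
      ≤⟨ ∑-mono (allFin n) (λ {r} _ → *-monoʳ-≤ (𝟙 (R r)) (*-monoʳ-≤ (a r c) (Φ-increment s u w≡ (R ∖ r) C))) ⟩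
    ∑ (allFin n) (λ r → 𝟙 (R r) * (a r c * (Φ v (R ∖ r) C + s * Φ w (R ∖ r) (u ∷ C))))
      ≡⟨ ∑-cong (allFin n) (λ r → distribute (𝟙 (R r)) (a r c) _ s _) ⟩
    ∑ (allFin n) (λ r → 𝟙 (R r) * (a r c * Φ v (R ∖ r) C) + s * (𝟙 (R r) * (a r c * Φ w (R ∖ r) (u ∷ C))))
      ≡⟨ ∑-+ (allFin n) _ _ ⟩
    Φ v R (c ∷ C) + ∑ (allFin n) (λ r → s * (𝟙 (R r) * (a r c * Φ w (R ∖ r) (u ∷ C))))
      ≡⟨ cong (Φ v R (c ∷ C) +_) (∑-*ˡ s (allFin n) _) ⟩
    Φ v R (c ∷ C) + s * Φ w R (c ∷ u ∷ C)
      ≡⟨ cong (λ z → Φ v R (c ∷ C) + s * z) (Φ-swap w R c u C) ⟩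
    Φ v R (c ∷ C) + s * Φ w R (u ∷ c ∷ C) ∎
    where
    open ≤-Reasoning
    distribute : ∀ b x y s z → b * (x * (y + s * z)) ≡ b * (x * y) + s * (b * (x * z))
    distribute = solve-∀

  ray : (Fin n → ℕ) → ℕ → Fin n → ℕ → Fin n → ℕ
  ray v s u i r = v r + i * (s * a r u)

  -- A discrete bound on the logarithmic derivative: `Φ-increment` bounds one step by the derivative
  -- at its far end, and `column-ratio-anti` bounds the logarithmic derivative there by the one at
  -- v. The form is additive because 1 - s b₁/b₀ would need subtraction.
  ray-growth : ∀ v s u i C →
    Φ (ray v s u (suc i)) full C * Φ v full C
      ≤ Φ (ray v s u i) full C * Φ v full C + s * Φ v full (u ∷ C) * Φ (ray v s u (suc i)) full C
  ray-growth v s u i C = begin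
    Φ w′ full C * b
      ≤⟨ *-monoˡ-≤ b (Φ-increment s u next full C) ⟩
    (Φ w full C + s * Φ w′ full (u ∷ C)) * b
      ≡⟨ trans (*-distribʳ-+ b (Φ w full C) _) (cong (Φ w full C * b +_) (*-assoc s _ b)) ⟩
    Φ w full C * b + s * (Φ w′ full (u ∷ C) * b)
      ≤⟨ +-monoʳ-≤ (Φ w full C * b) (*-monoʳ-≤ s (column-ratio-anti (λ r → m≤m+n (v r) _) (length C) full u C refl)) ⟩
    Φ w full C * b + s * (Φ v full (u ∷ C) * Φ w′ full C)
      ≡⟨ cong (Φ w full C * b +_) (sym (*-assoc s _ _)) ⟩
    Φ w full C * b + s * Φ v full (u ∷ C) * Φ w′ full C ∎
    where
    open ≤-Reasoning
    w  = ray v s u i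
    w′ = ray v s u (suc i)
    b  = Φ v full C
    next : ∀ r → w′ r ≡ w r + s * a r u
    next r = regroup (v r) (s * a r u) (i * (s * a r u))
      where
      regroup : ∀ x y z → x + (y + z) ≡ x + z + y
      regroup = solve-∀

-- Capacity and the extraction of linear coefficients.

module Capacity {n : ℕ} (a : Fin n → Fin n → ℕ) (a≤1 : ∀ r c → a r c ≤ 1) where
  open Matching a
  open Homogeneity a

  -- The slack x₀ keeps every entry positive, hence Φ nonzero.
  point : ℕ → List (Fin n × ℕ) → Fin n → ℕ
  point x₀ xs r = x₀ + ∑ xs (λ (c , t) → t * a r c)

  -- Φ (point x₀ xs) full C is a polynomial in the values attached to the columns U; its capacity is
  -- at least α / β.
  Cap : ℕ → ℕ → List (Fin n) → List (Fin n) → Set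
  Cap α β U C = ∀ x₀ xs → 1 ≤ x₀ → map proj₁ xs ≡ U →
                α * ∏ xs proj₂ ≤ β * Φ (point x₀ xs) full C

  scale : ℕ → List (Fin n × ℕ) → List (Fin n × ℕ)
  scale l = map (λ (c , t) → c , l * t)

  point-scale : ∀ l x₀ xs r → point (l * x₀) (scale l xs) r ≡ l * point x₀ xs r
  point-scale l x₀ xs r = begin
    l * x₀ + ∑ (scale l xs) (λ (c , t) → t * a r c)
      ≡⟨ cong (l * x₀ +_) (∑-map _ xs _) ⟩
    l * x₀ + ∑ xs (λ (c , t) → l * t * a r c)
      ≡⟨ cong (l * x₀ +_) (trans (∑-cong xs (λ (c , t) → *-assoc l t (a r c))) (∑-*ˡ l xs _)) ⟩
    l * x₀ + l * ∑ xs (λ (c , t) → t * a r c)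
      ≡⟨ *-distribˡ-+ l x₀ _ ⟨
    l * point x₀ xs r ∎
    where open ≡-Reasoning

  ∏-scale : ∀ l xs → ∏ (scale l xs) proj₂ ≡ l ^ length xs * ∏ xs proj₂
  ∏-scale l xs = begin
    ∏ (scale l xs) proj₂            ≡⟨ ∏-map _ xs proj₂ ⟩
    ∏ xs (λ (c , t) → l * t)        ≡⟨ ∏-* xs (λ _ → l) proj₂ ⟩
    ∏ xs (λ _ → l) * ∏ xs proj₂     ≡⟨ cong (_* ∏ xs proj₂) (∏-const l xs) ⟩
    l ^ length xs * ∏ xs proj₂      ∎
    where open ≡-Reasoning

  map-proj₁-scale : ∀ l xs → map proj₁ (scale l xs) ≡ map proj₁ xs
  map-proj₁-scale l xs = sym (map-∘ xs)

  count-full : ∑ (allFin n) (λ r → 𝟙 (full r)) ≡ n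
  count-full = trans (sym (length-∑ (allFin n))) (length-allFin n)

  module _ (e α β : ℕ) (u : Fin n) (C : List (Fin n)) (1≤α : 1 ≤ α)
           (x₀ : ℕ) (xs : List (Fin n × ℕ)) (1≤x₀ : 1 ≤ x₀)
           (degree : n ≡ length C + suc (length xs))
           (cap : Cap α β (u ∷ map proj₁ xs) C) where

    private
      N = suc e
      m = length xs
      p = ∏ xs proj₂
      v = point x₀ xs
      b₀ = Φ v full C
      b₁ = Φ v full (u ∷ C)

    degree-C : ∑ (allFin n) (λ r → 𝟙 (full r)) ≡ length C + suc m
    degree-C = trans count-full degree

    degree-uC : ∑ (allFin n) (λ r → 𝟙 (full r)) ≡ length (u ∷ C) + m
    degree-uC = trans degree-C (+-suc (length C) m)

    cap-ray : ∀ i → α * (i * p) ≤ β * Φ (ray v 1 u i) full C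
    cap-ray i = ≤-trans (cap x₀ ((u , i) ∷ xs) 1≤x₀ refl)
      (≤-reflexive (cong (β *_) (Φ-cong (λ r → regroup x₀ i (a r u) _) (λ _ → refl) C)))
      where
      regroup : ∀ x i y z → x + (i * y + z) ≡ x + z + i * (1 * y)
      regroup = solve-∀

    -- Entries of a are at most 1, and the slack makes every `v r` at least 1, so one step along the
    -- ray stays below 2v. By homogeneity b₀ = 0 would force Φ to vanish there, against the
    -- capacity.
    b₀>0 : 1 ≤ p → 1 ≤ b₀
    b₀>0 1≤p with b₀ in eq
    ... | suc _ = s≤s z≤n
    ... | zero  = contradiction (≤-trans (*-mono-≤ 1≤α (*-mono-≤ (≤-refl {1}) 1≤p)) (cap-ray 1)) (<⇒≱ (s≤s (begin
        β * Φ (ray v 1 u 1) full C       ≤⟨ *-monoʳ-≤ β (Φ-mono ray≤2v full C) ⟩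
        β * Φ (λ r → 2 * v r) full C     ≡⟨ cong (β *_) (Φ-homogeneous 2 v full C (suc m) degree-C) ⟩
        β * (2 ^ suc m * Φ v full C)     ≡⟨ cong (λ z → β * (2 ^ suc m * z)) eq ⟩
        β * (2 ^ suc m * 0)              ≡⟨ trans (cong (β *_) (*-zeroʳ (2 ^ suc m))) (*-zeroʳ β) ⟩
        0                                ∎)))
      where
      open ≤-Reasoning
      ray≤2v : ∀ r → ray v 1 u 1 r ≤ 2 * v r
      ray≤2v r = +-monoʳ-≤ (v r) (+-monoˡ-≤ 0 (≤-trans (≤-reflexive (+-identityʳ (a r u)))
        (≤-trans (a≤1 r u) (≤-trans 1≤x₀ (m≤m+n x₀ _)))))

    -- If b₁ = 0 then Φ is constant along the ray, although the capacity forces linear growth.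
    b₁>0 : 1 ≤ p → 1 ≤ b₁
    b₁>0 1≤p with b₁ in eq
    ... | suc _ = s≤s z≤n
    ... | zero  = contradiction (≤-trans (cap-ray (suc (β * b₀))) (*-monoʳ-≤ β (bounded (suc (β * b₀)))))
                    (<⇒≱ (≤-trans (≤-reflexive (sym (*-identityʳ _)))
                      (≤-trans (*-monoʳ-≤ (suc (β * b₀)) 1≤p) (≤-trans (≤-reflexive (sym (*-identityˡ _)))
                        (*-monoˡ-≤ (suc (β * b₀) * p) 1≤α)))))
      where
      open ≤-Reasoning
      instance
        b₀≢0 : NonZero b₀
        b₀≢0 = >-nonZero (b₀>0 1≤p)
      bounded : ∀ i → Φ (ray v 1 u i) full C ≤ b₀
      bounded zero    = ≤-reflexive (Φ-cong (λ r → +-identityʳ (v r)) (λ _ → refl) C)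
      bounded (suc i) = ≤-trans (*-cancelʳ-≤ _ _ b₀ (≤-trans (ray-growth v 1 u i C) (≤-reflexive
        (trans (cong (λ z → Φ (ray v 1 u i) full C * b₀ + 1 * z * Φ (ray v 1 u (suc i)) full C) eq) (+-identityʳ _))))) (bounded i)

    -- Along the ray v + t u the logarithmic derivative of Φ is at most b₁ / b₀, its value at v. The
    -- scaling makes a unit step raise log Φ by at most − log (1 − 1 / N), and the capacity is
    -- tested after N steps.
    capacity-drop : 1 ≤ p → α * e ^ N * p ≤ β * N ^ N * b₁
    capacity-drop 1≤p = *-cancelʳ-≤ _ _ (N * (l ^ m * b₀)) ⦃ m*n≢0 N _ ⦃ _ ⦄ ⦃ m*n≢0 (l ^ m) b₀ ⦃ m^n≢0 l m ⦄ ⦄ ⦄ (begin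
      α * e ^ N * p * (N * (l ^ m * b₀))
        ≡⟨ regroup₁ α (e ^ N) p N (l ^ m) b₀ ⟩
      e ^ N * (α * (N * b₀ * (l ^ m * p)))
        ≤⟨ *-monoʳ-≤ (e ^ N) cap-at ⟩
      e ^ N * (β * X N)
        ≡⟨ regroup₂ (e ^ N) β (X N) ⟩
      β * (e ^ N * X N)
        ≤⟨ *-monoʳ-≤ β (growth N) ⟩
      β * (N ^ N * (N * K))
        ≡⟨ regroup₃ β (N ^ N) N (l ^ m) b₁ b₀ ⟩
      β * N ^ N * b₁ * (N * (l ^ m * b₀)) ∎)
      where
      open ≤-Reasoning
      instance
        b₀≢0 : NonZero b₀
        b₀≢0 = >-nonZero (b₀>0 1≤p)
        b₁≢0 : NonZero b₁
        b₁≢0 = >-nonZero (b₁>0 1≤p)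
      -- Φ has degree m + 1 and its derivative along u has degree m, so scaling v by l divides the
      -- logarithmic derivative b₁/b₀ by l. With steps of size b₀ the relative rate at `v′` is
      -- exactly 1/N: the two values are N K and K.
      l = N * b₁
      instance
        l≢0 : NonZero l
        l≢0 = m*n≢0 N b₁
      K = l ^ m * b₁ * b₀
      instance
        K≢0 : NonZero K
        K≢0 = m*n≢0 (l ^ m * b₁) b₀ ⦃ m*n≢0 (l ^ m) b₁ ⦃ m^n≢0 l m ⦄ ⦄
      v′ : Fin n → ℕ
      v′ r = l * v r
      X : ℕ → ℕ
      X i = Φ (ray v′ b₀ u i) full C
      regroup₁ : ∀ x y p N q b → x * y * p * (N * (q * b)) ≡ y * (x * (N * b * (q * p)))
      regroup₁ = solve-∀
      regroup₂ : ∀ x y z → x * (y * z) ≡ y * (x * z)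
      regroup₂ = solve-∀
      regroup₃ : ∀ x y N q b₁ b₀ → x * (y * (N * (q * b₁ * b₀))) ≡ x * y * b₁ * (N * (q * b₀))
      regroup₃ = solve-∀
      cap-at : α * (N * b₀ * (l ^ m * p)) ≤ β * X N
      cap-at = begin
        α * (N * b₀ * (l ^ m * p))
          ≡⟨ cong (λ z → α * (N * b₀ * z)) (∏-scale l xs) ⟨
        α * (N * b₀ * ∏ (scale l xs) proj₂)
          ≤⟨ cap (l * x₀) ((u , N * b₀) ∷ scale l xs) (≤-trans 1≤x₀ (m≤n*m x₀ l)) (cong (u ∷_) (map-proj₁-scale l xs)) ⟩
        β * Φ (point (l * x₀) ((u , N * b₀) ∷ scale l xs)) full C
          ≡⟨ cong (β *_) (Φ-cong (λ r → trans (regroup (l * x₀) N b₀ (a r u) _) (cong (_+ N * (b₀ * a r u)) (point-scale l x₀ xs r))) (λ _ → refl) C) ⟩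
        β * X N ∎
        where
        regroup : ∀ x N b y z → x + (N * b * y + z) ≡ x + z + N * (b * y)
        regroup = solve-∀
      Φv′C : Φ v′ full C ≡ N * K
      Φv′C = trans (Φ-homogeneous l v full C (suc m) degree-C) (regroup N b₁ (l ^ m) b₀)
        where
        regroup : ∀ N b q c → N * b * q * c ≡ N * (q * b * c)
        regroup = solve-∀
      Φv′uC : b₀ * Φ v′ full (u ∷ C) ≡ K
      Φv′uC = trans (cong (b₀ *_) (Φ-homogeneous l v full (u ∷ C) m degree-uC)) (*-comm b₀ _)
      step : ∀ i → e * X (suc i) ≤ N * X i
      step i = *-cancelʳ-≤ _ _ K (+-cancelʳ-≤ (K * X (suc i)) _ _ (begin
        e * X (suc i) * K + K * X (suc i)
          ≡⟨ regroup e (X (suc i)) K ⟩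
        X (suc i) * (N * K)
          ≡⟨ cong (X (suc i) *_) Φv′C ⟨
        X (suc i) * Φ v′ full C
          ≤⟨ ray-growth v′ b₀ u i C ⟩
        X i * Φ v′ full C + b₀ * Φ v′ full (u ∷ C) * X (suc i)
          ≡⟨ cong₂ (λ y z → X i * y + z * X (suc i)) Φv′C Φv′uC ⟩
        X i * (N * K) + K * X (suc i)
          ≡⟨ cong (_+ K * X (suc i)) (regroup′ (X i) N K) ⟩
        N * X i * K + K * X (suc i) ∎))
        where
        regroup : ∀ e x k → e * x * k + k * x ≡ x * (suc e * k)
        regroup = solve-∀
        regroup′ : ∀ x y z → x * (y * z) ≡ y * x * z
        regroup′ = solve-∀
      growth : ∀ i → e ^ i * X i ≤ N ^ i * (N * K)
      growth zero    = *-monoʳ-≤ 1 (≤-reflexive (trans (Φ-cong (λ r → +-identityʳ (v′ r)) (λ _ → refl) C) Φv′C))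
      growth (suc i) = begin
        e * e ^ i * X (suc i)       ≡⟨ regroup e (e ^ i) (X (suc i)) ⟩
        e ^ i * (e * X (suc i))     ≤⟨ *-monoʳ-≤ (e ^ i) (step i) ⟩
        e ^ i * (N * X i)           ≡⟨ regroup₂ (e ^ i) N (X i) ⟩
        N * (e ^ i * X i)           ≤⟨ *-monoʳ-≤ N (growth i) ⟩
        N * (N ^ i * (N * K))       ≡⟨ *-assoc N (N ^ i) (N * K) ⟨
        N * N ^ i * (N * K)         ∎
        where
        regroup : ∀ x y z → x * y * z ≡ y * (x * z)
        regroup = solve-∀

  cap-step : ∀ e α β u U C → 1 ≤ α → n ≡ length C + length (u ∷ U) →
             Cap α β (u ∷ U) C → Cap (α * e ^ suc e) (β * suc e ^ suc e) U (u ∷ C)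
  cap-step e α β u .(map proj₁ xs) C 1≤α degree cap x₀ xs 1≤x₀ refl with 1 ≤? ∏ xs proj₂
  ... | yes 1≤p = capacity-drop e α β u C 1≤α x₀ xs 1≤x₀ (trans degree (cong (λ k → length C + suc k) (length-map proj₁ xs))) cap 1≤p
  -- Some remaining variable is zero and the left side vanishes; the positivity of b₀ and b₁ comes
  -- only from the other case.
  ... | no  p<1 rewrite n<1⇒n≡0 (≰⇒> p<1) | *-zeroʳ (α * e ^ suc e) = z≤n

  cap-all : ∀ e α β U C → 1 ≤ e → 1 ≤ α → n ≡ length C + length U →
            Cap α β U C → Cap (α * (e ^ suc e) ^ length U) (β * (suc e ^ suc e) ^ length U) [] (U ʳ++ C)
  cap-all e α β []      C 1≤e 1≤α degree cap =
    subst₂ (λ α β → Cap α β [] C) (sym (*-identityʳ α)) (sym (*-identityʳ β)) cap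
  cap-all e α β (u ∷ U) C 1≤e 1≤α degree cap =
    subst₂ (λ α β → Cap α β [] (U ʳ++ (u ∷ C))) (*-assoc α _ _) (*-assoc β _ _)
      (cap-all e (α * e ^ suc e) (β * suc e ^ suc e) U (u ∷ C) 1≤e
        (*-mono-≤ 1≤α (m^n>0 e ⦃ >-nonZero 1≤e ⦄ (suc e)))
        (trans degree (+-suc (length C) (length U)))
        (cap-step e α β u U C 1≤α degree cap))

-- The lower bound for regular digraphs.

filterB-length : {A : Set} (p : A → Bool) (xs : List A) → length (filterB p xs) ≡ ∑ xs (λ x → 𝟙 (p x))
filterB-length p xs = trans (length-∑ (filterB p xs)) (∑-filterB p xs (λ _ → 1))

module LowerBound {n d : ℕ} .⦃ _ : NonZero d ⦄ (G : Digraph n) (reg : Regular d G) where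

  a : Fin n → Fin n → ℕ
  a r c = 𝟙 (G c r)

  a≤1 : ∀ r c → a r c ≤ 1
  a≤1 r c with G c r
  ... | true  = ≤-refl
  ... | false = z≤n

  open Matching a
  open Capacity a a≤1

  -- In-degree d gives each row exactly d variables for AM-GM. Out-degree d puts each variable into
  -- exactly d rows, so the row products multiply to the d-th power of ∏ x_w. The slack is only
  -- dropped from the row sums.
  cap-initial : ∀ U → U ↭ allFin n → Cap (d ^ n) 1 U []
  cap-initial .(map proj₁ xs) perm x₀ xs 1≤x₀ refl = ^-cancelʳ-≤ d (begin
    (d ^ n * ∏ xs proj₂) ^ d
      ≡⟨ ^-distribʳ-* (d ^ n) (∏ xs proj₂) d ⟩
    (d ^ n) ^ d * ∏ xs proj₂ ^ d
      ≡⟨ cong₂ _*_ powers columns ⟩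
    ∏ (allFin n) (λ _ → d ^ d) * ∏ (allFin n) chosen
      ≡⟨ ∏-* (allFin n) (λ _ → d ^ d) chosen ⟨
    ∏ (allFin n) (λ r → d ^ d * chosen r)
      ≤⟨ ∏-mono (allFin n) (λ {r} _ → row r) ⟩
    ∏ (allFin n) (λ r → point x₀ xs r ^ d)
      ≡⟨ ∏-^ d (allFin n) (point x₀ xs) ⟩
    Φ (point x₀ xs) full [] ^ d
      ≡⟨ cong (_^ d) (+-identityʳ _) ⟨
    (1 * Φ (point x₀ xs) full []) ^ d ∎)
    where
    open ≤-Reasoning
    chosen : Fin n → ℕ
    chosen r = ∏ xs (λ (c , t) → if G c r then t else 1)
    powers : (d ^ n) ^ d ≡ ∏ (allFin n) (λ _ → d ^ d)
    powers = trans (^-*-assoc d n d) (trans (cong (d ^_) (*-comm n d)) (trans (sym (^-*-assoc d d n))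
      (trans (cong ((d ^ d) ^_) (sym (length-allFin n))) (sym (∏-const (d ^ d) (allFin n))))))
    columns : ∏ xs proj₂ ^ d ≡ ∏ (allFin n) chosen
    columns = trans (sym (∏-^ d xs proj₂)) (trans (∏-cong xs (λ (c , t) → trans (cong (t ^_) (sym (proj₁ (reg c))))
      (sym (∏-if (allFin n) (G c) t)))) (∏-swap xs (allFin n) _))
    neighbours : ∀ r → List (Fin n × ℕ)
    neighbours r = filterB (λ (c , t) → G c r) xs
    neighbours-length : ∀ r → length (neighbours r) ≡ d
    neighbours-length r = trans (filterB-length _ xs) (trans (sym (∑-map proj₁ xs (λ c → 𝟙 (G c r))))
      (trans (sum-↭ (map⁺ (λ c → 𝟙 (G c r)) perm)) (proj₂ (reg r))))
    neighbours-sum : ∀ r → ∑ (neighbours r) proj₂ ≤ point x₀ xs r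
    neighbours-sum r = ≤-trans (≤-reflexive (trans (∑-filterB _ xs proj₂) (∑-cong xs (λ (c , t) → weight (G c r) t)))) (m≤n+m _ x₀)
      where
      weight : ∀ b t → (if b then t else 0) ≡ t * 𝟙 b
      weight true  t = sym (*-identityʳ t)
      weight false t = sym (*-zeroʳ t)
    row : ∀ r → d ^ d * chosen r ≤ point x₀ xs r ^ d
    row r = ≤-trans (subst (λ k → k ^ k * chosen r ≤ ∑ (neighbours r) proj₂ ^ k) (neighbours-length r)
      (subst (λ z → length (neighbours r) ^ length (neighbours r) * z ≤ ∑ (neighbours r) proj₂ ^ length (neighbours r))
        (∏-filterB _ xs proj₂) (AM-GM (neighbours r) proj₂)))
      (^-monoˡ-≤ d (neighbours-sum r))

  Φ-lower-bound : ∀ e → 1 ≤ e → d ^ n * (e ^ suc e) ^ n ≤ (suc e ^ suc e) ^ n * Φ (λ _ → 1) full (allFin n)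
  Φ-lower-bound e 1≤e = begin
    d ^ n * (e ^ suc e) ^ n
      ≡⟨ cong (λ k → d ^ n * (e ^ suc e) ^ k) (length-allFin n) ⟨
    d ^ n * (e ^ suc e) ^ length (allFin n)
      ≡⟨ *-identityʳ _ ⟨
    d ^ n * (e ^ suc e) ^ length (allFin n) * 1
      -- All columns are extracted, so no variable is left, and the least admissible slack 1 makes
      -- the point the constant function 1.
      ≤⟨ cap-all e (d ^ n) 1 (allFin n) [] 1≤e (m^n>0 d n) (sym (length-allFin n)) (cap-initial (allFin n) ↭-refl) 1 [] ≤-refl refl ⟩
    1 * (suc e ^ suc e) ^ length (allFin n) * Φ (point 1 []) full (reverse (allFin n))
      ≡⟨ cong₂ _*_ (trans (*-identityˡ _) (cong ((suc e ^ suc e) ^_) (length-allFin n))) (Φ-↭ (point 1 []) full (↭-reverse (allFin n))) ⟩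
    (suc e ^ suc e) ^ n * Φ (λ _ → 1) full (allFin n) ∎
    where open ≤-Reasoning

-- Boolean tests and their meaning; full matchings as cycle-factors.

module _ {n : ℕ} {p : Fin n → Bool} where

  allB-intro : (∀ i → p i ≡ true) → allB p ≡ true
  allB-intro h = go (allFin n)
    where
    go : ∀ xs → and (map p xs) ≡ true
    go []       = refl
    go (x ∷ xs) = cong₂ _∧_ (h x) (go xs)

  allB-elim : allB p ≡ true → ∀ i → p i ≡ true
  allB-elim all i = go (allFin n) all (∈-allFin i)
    where
    go : ∀ xs → and (map p xs) ≡ true → ∀ {i} → i ∈ xs → p i ≡ true
    go (x ∷ xs) eq i∈         with p x in px
    go (x ∷ xs) eq (here refl) | true = px
    go (x ∷ xs) eq (there i∈)  | true = go xs eq i∈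

∧-elim : ∀ {a b} → a ∧ b ≡ true → a ≡ true × b ≡ true
∧-elim {true} {true} refl = refl , refl

module _ {n : ℕ} (σ : Vec (Fin n) n) where

  isInjective-intro : Injective _≡_ _≡_ (lookupᵥ σ) → isInjective σ ≡ true
  isInjective-intro inj = allB-intro (λ u → allB-intro (pair u))
    where
    pair : ∀ u v → ⌊ u ≟ v ⌋ ∨ not ⌊ lookupᵥ σ u ≟ lookupᵥ σ v ⌋ ≡ true
    pair u v with u ≟ v | lookupᵥ σ u ≟ lookupᵥ σ v
    ... | yes _ | _     = refl
    ... | no  _ | no  _ = refl
    ... | no ¬p | yes p = ⊥-elim (¬p (inj p))

  isInjective-elim : isInjective σ ≡ true → Injective _≡_ _≡_ (lookupᵥ σ)
  isInjective-elim isInj {u} {v} eq = pair (allB-elim (allB-elim isInj u) v)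
    where
    pair : ⌊ u ≟ v ⌋ ∨ not ⌊ lookupᵥ σ u ≟ lookupᵥ σ v ⌋ ≡ true → u ≡ v
    pair h with u ≟ v | lookupᵥ σ u ≟ lookupᵥ σ v
    ... | yes p | _     = p
    ... | no  _ | no ¬q = ⊥-elim (¬q eq)
    pair () | no _ | yes _

module _ {n : ℕ} (G : Digraph n) where

  open Matching (λ r c → 𝟙 (G c r))

  choice-weight : ∀ {k} → (Fin n → Bool) → (Fin k → Fin n) → Vec (Fin n) k → ℕ
  choice-weight R c []ᵥ      = 1
  choice-weight R c (r ∷ᵥ σ) = 𝟙 (R r) * (𝟙 (G (c zero) r) * choice-weight (R ∖ r) (c ∘ suc) σ)

  Φ-choices : ∀ k (R : Fin n → Bool) (c : Fin k → Fin n) →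
              Φ (λ _ → 1) R (tabulate c) ≡ ∑ (allVecs n k) (choice-weight R c)
  Φ-choices zero    R c = trans (∏-if (allFin n) R 1) (^-zeroˡ (∑ (allFin n) (λ r → 𝟙 (R r))))
  Φ-choices (suc k) R c = begin
    ∑ (allFin n) (λ r → 𝟙 (R r) * (𝟙 (G (c zero) r) * Φ (λ _ → 1) (R ∖ r) (tabulate (c ∘ suc))))
      ≡⟨ ∑-cong (allFin n) first ⟩
    ∑ (allFin n) (λ r → ∑ (map (r ∷ᵥ_) (allVecs n k)) (choice-weight R c))
      ≡⟨ ∑-concatMap (λ r → map (r ∷ᵥ_) (allVecs n k)) (allFin n) (choice-weight R c) ⟨
    ∑ (allVecs n (suc k)) (choice-weight R c) ∎
    where
    open ≡-Reasoning
    first : ∀ r → 𝟙 (R r) * (𝟙 (G (c zero) r) * Φ (λ _ → 1) (R ∖ r) (tabulate (c ∘ suc)))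
                ≡ ∑ (map (r ∷ᵥ_) (allVecs n k)) (choice-weight R c)
    first r = begin
      b * (g * Φ (λ _ → 1) (R ∖ r) (tabulate (c ∘ suc)))
        ≡⟨ cong (λ z → b * (g * z)) (Φ-choices k (R ∖ r) (c ∘ suc)) ⟩
      b * (g * ∑ (allVecs n k) (choice-weight (R ∖ r) (c ∘ suc)))
        ≡⟨ cong (b *_) (∑-*ˡ g (allVecs n k) _) ⟨
      b * ∑ (allVecs n k) (λ σ → g * choice-weight (R ∖ r) (c ∘ suc) σ)
        ≡⟨ ∑-*ˡ b (allVecs n k) _ ⟨
      ∑ (allVecs n k) (λ σ → choice-weight R c (r ∷ᵥ σ))
        ≡⟨ ∑-map (r ∷ᵥ_) (allVecs n k) (choice-weight R c) ⟨
      ∑ (map (r ∷ᵥ_) (allVecs n k)) (choice-weight R c) ∎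
      where
      b = 𝟙 (R r)
      g = 𝟙 (G (c zero) r)

  Valid : ∀ {k} → (Fin n → Bool) → (Fin k → Fin n) → Vec (Fin n) k → Set
  Valid R c σ = (∀ i → R (lookupᵥ σ i) ≡ true) × (∀ i → G (c i) (lookupᵥ σ i) ≡ true)
              × Injective _≡_ _≡_ (lookupᵥ σ)

  choice-weight-valid : ∀ {k} R (c : Fin k → Fin n) σ →
    choice-weight R c σ ≡ 0 ⊎ choice-weight R c σ ≡ 1 × Valid R c σ
  choice-weight-valid R c []ᵥ = inj₂ (refl , (λ ()) , (λ ()) , λ { {()} })
  choice-weight-valid R c (r ∷ᵥ σ) with R r in Rr | G (c zero) r in Gr | choice-weight-valid (R ∖ r) (c ∘ suc) σ
  ... | false | _     | _       = inj₁ refl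
  ... | true  | false | _       = inj₁ refl
  ... | true  | true  | inj₁ w0 = inj₁ (trans (+-identityʳ _) (trans (+-identityʳ _) w0))
  ... | true  | true  | inj₂ (w1 , inR , inG , inj) =
    inj₂ (trans (+-identityʳ _) (trans (+-identityʳ _) w1) , inR′ , inG′ , inj′)
    where
    inR′ : ∀ i → R (lookupᵥ (r ∷ᵥ σ) i) ≡ true
    inR′ zero    = Rr
    inR′ (suc i) = proj₁ (∧-elim (inR i))
    inG′ : ∀ i → G (c i) (lookupᵥ (r ∷ᵥ σ) i) ≡ true
    inG′ zero    = Gr
    inG′ (suc i) = inG i
    fresh : ∀ i → lookupᵥ σ i ≢ r
    fresh i eq with lookupᵥ σ i ≟ r | proj₂ (∧-elim {R (lookupᵥ σ i)} (inR i))
    ... | no ¬p | _ = ¬p eq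
    inj′ : Injective _≡_ _≡_ (lookupᵥ (r ∷ᵥ σ))
    inj′ {zero}  {zero}  eq = refl
    inj′ {zero}  {suc j} eq = ⊥-elim (fresh j (sym eq))
    inj′ {suc i} {zero}  eq = ⊥-elim (fresh i eq)
    inj′ {suc i} {suc j} eq = cong suc (inj eq)

  -- A column is a vertex and its row is the image of that vertex. A nonzero choice weight is 1 and
  -- certifies distinct images along edges.
  Φ≤cycleFactors : Φ (λ _ → 1) full (allFin n) ≤ length (cycleFactors G)
  Φ≤cycleFactors = begin
    Φ (λ _ → 1) full (allFin n)
      ≡⟨ Φ-choices n full id ⟩
    ∑ (allVecs n n) (choice-weight full id)
      ≤⟨ ∑-mono (allVecs n n) (λ {σ} _ → bound σ) ⟩
    ∑ (allVecs n n) (λ σ → 𝟙 (isCycleFactor G σ))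
      ≡⟨ filterB-length (isCycleFactor G) (allVecs n n) ⟨
    length (cycleFactors G) ∎
    where
    open ≤-Reasoning
    bound : ∀ σ → choice-weight full id σ ≤ 𝟙 (isCycleFactor G σ)
    bound σ with choice-weight-valid full id σ
    ... | inj₁ w0 = ≤-trans (≤-reflexive w0) z≤n
    ... | inj₂ (w1 , _ , inG , inj) = ≤-reflexive (trans w1 (sym (cong 𝟙
            (cong₂ _∧_ (isInjective-intro σ inj) (allB-intro inG)))))

-- Filtered lists and comparison of lengths.

module _ {A : Set} {p : A → Bool} where

  filterB-∈⁻ : ∀ xs {x} → x ∈ filterB p xs → x ∈ xs × p x ≡ true
  filterB-∈⁻ (x ∷ xs) x∈ with p x in px
  filterB-∈⁻ (x ∷ xs) (here refl) | true  = here refl , px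
  filterB-∈⁻ (x ∷ xs) (there x∈)  | true  = let x∈xs , py = filterB-∈⁻ xs x∈ in there x∈xs , py
  filterB-∈⁻ (x ∷ xs) x∈          | false = let x∈xs , py = filterB-∈⁻ xs x∈ in there x∈xs , py

  filterB-∈⁺ : ∀ xs {x} → x ∈ xs → p x ≡ true → x ∈ filterB p xs
  filterB-∈⁺ (x ∷ xs) (here refl) px rewrite px = here refl
  filterB-∈⁺ (x ∷ xs) (there y∈)  py with p x
  ... | true  = there (filterB-∈⁺ xs y∈ py)
  ... | false = filterB-∈⁺ xs y∈ py

  filterB-unique : ∀ {xs} → Unique xs → Unique (filterB p xs)
  filterB-unique {[]}     []          = []
  filterB-unique {x ∷ xs} (x∉ ∷ uniq) with p x
  ... | true  = All.tabulate (λ y∈ → All.lookup x∉ (proj₁ (filterB-∈⁻ xs y∈))) ∷ filterB-unique uniq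
  ... | false = filterB-unique uniq

unique-lookup : {A : Set} {xs : List A} → Unique xs → Injective _≡_ _≡_ (lookup xs)
unique-lookup (x∉ ∷ uniq) {zero}  {zero}  eq = refl
unique-lookup (x∉ ∷ uniq) {zero}  {suc j} eq = ⊥-elim (All.lookup x∉ (∈-lookup j) eq)
unique-lookup (x∉ ∷ uniq) {suc i} {zero}  eq = ⊥-elim (All.lookup x∉ (∈-lookup i) (sym eq))
unique-lookup (x∉ ∷ uniq) {suc i} {suc j} eq = cong suc (unique-lookup uniq eq)

-- Positions in `xs` are sent injectively to positions in `ys`. A relation takes the place of a
-- function because later the partner of a cycle is merely known to exist.
length-injection : {A B : Set} {xs : List A} {ys : List B} (_~_ : A → B → Set) → Unique xs →
                   (∀ {x} → x ∈ xs → ∃[ y ] y ∈ ys × x ~ y) →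
                   (∀ {x x′ y} → x ∈ xs → x′ ∈ xs → x ~ y → x′ ~ y → x ≡ x′) →
                   length xs ≤ length ys
length-injection {xs = xs} {ys} _~_ uniq total determined = injective⇒≤ {f = f} f-injective
  where
  image : ∀ i → ∃[ y ] y ∈ ys × lookup xs i ~ y
  image i = total (∈-lookup i)
  f : Fin (length xs) → Fin (length ys)
  f i = index (proj₁ (proj₂ (image i)))
  f-injective : Injective _≡_ _≡_ f
  f-injective {i} {j} eq = unique-lookup uniq (determined (∈-lookup i) (∈-lookup j) (proj₂ (proj₂ (image i)))
    (subst (lookup xs j ~_) (trans (lookup-index (proj₁ (proj₂ (image j))))
      (trans (cong (lookup ys) (sym eq)) (sym (lookup-index (proj₁ (proj₂ (image i))))))) (proj₂ (proj₂ (image j)))))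

-- Orbits of a permutation.

module Orbits {n : ℕ} (σ : Vec (Fin n) n) (inj : Injective _≡_ _≡_ (lookupᵥ σ)) where

  Reaches : Fin n → Fin n → Set
  Reaches x y = ∃[ k ] iter σ k x ≡ y

  iter-+ : ∀ j k x → iter σ (j + k) x ≡ iter σ j (iter σ k x)
  iter-+ zero    k x = refl
  iter-+ (suc j) k x = cong (lookupᵥ σ) (iter-+ j k x)

  iter-injective : ∀ k {x y} → iter σ k x ≡ iter σ k y → x ≡ y
  iter-injective zero    eq = eq
  iter-injective (suc k) eq = iter-injective k (inj eq)

  -- Two of the iterates with exponents 0, ..., n agree, and injectivity cancels the smaller
  -- exponent. The bound by n matters because `isCycleMin` inspects only the exponents below n.
  period : ∀ x → ∃[ p ] suc p ≤ n × iter σ (suc p) x ≡ x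
  period x with i , j , i<j , eq ← pigeonhole (n<1+n n) (λ i → iter σ (toℕ i) x)
           with p , i+p≡j ← m≤n⇒∃[o]m+o≡n i<j =
    p , ≤-trans (m+n≤o⇒n≤o (toℕ i) (≤-reflexive (trans (+-suc (toℕ i) p) i+p≡j))) (s≤s⁻¹ (toℕ<n j)) ,
    sym (iter-injective (toℕ i) (trans eq (trans (cong (λ k → iter σ k x) (trans (sym i+p≡j) (sym (+-suc (toℕ i) p))))
      (iter-+ (toℕ i) (suc p) x))))

  iter-multiple : ∀ q m {x} → iter σ q x ≡ x → iter σ (m * q) x ≡ x
  iter-multiple q zero    eq = refl
  iter-multiple q (suc m) eq = trans (iter-+ q (m * q) _) (trans (cong (iter σ q) (iter-multiple q m eq)) eq)

  reaches-trans : ∀ {x y z} → Reaches x y → Reaches y z → Reaches x z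
  reaches-trans {x} (j , eqj) (k , eqk) = k + j , trans (iter-+ k j x) (trans (cong (iter σ k) eqj) eqk)

  reaches-sym : ∀ {x y} → Reaches x y → Reaches y x
  -- `k * suc p` is a multiple of a period of x and at least k, so the remaining steps lead from y
  -- back to x.
  reaches-sym {x} {y} (k , eq) with p , _ , periodic ← period x = k * suc p ∸ k ,
    trans (cong (iter σ (k * suc p ∸ k)) (sym eq)) (trans (sym (iter-+ (k * suc p ∸ k) k x))
      (trans (cong (λ m → iter σ m x) (m∸n+n≡m (m≤m*n k (suc p)))) (iter-multiple (suc p) k periodic)))

  cycleMin-≤ : ∀ {x y} → isCycleMin σ x ≡ true → Reaches x y → toℕ x ≤ toℕ y
  cycleMin-≤ {x} {y} min (k , eq) with p , p<n , periodic ← period x =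
    subst (λ z → toℕ x ≤ toℕ z) reduced
      (≤ᵇ⇒≤ (toℕ x) _ (Equivalence.from T-≡ (allB-elim min (fromℕ< r<n))))
    where
    r<n : k % suc p < n
    r<n = <-≤-trans (m%n<n k (suc p)) p<n
    reduced : iter σ (toℕ (fromℕ< r<n)) x ≡ y
    reduced = begin
      iter σ (toℕ (fromℕ< r<n)) x                          ≡⟨ cong (λ m → iter σ m x) (toℕ-fromℕ< r<n) ⟩
      iter σ (k % suc p) x                                 ≡⟨ cong (iter σ (k % suc p)) (iter-multiple (suc p) (k / suc p) periodic) ⟨
      iter σ (k % suc p) (iter σ (k / suc p * suc p) x)    ≡⟨ iter-+ (k % suc p) (k / suc p * suc p) x ⟨
      iter σ (k % suc p + k / suc p * suc p) x             ≡⟨ cong (λ m → iter σ m x) (m≡m%n+[m/n]*n k (suc p)) ⟨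
      iter σ k x                                           ≡⟨ eq ⟩
      y                                                    ∎
      where open ≡-Reasoning

-- Revealing a permutation arc by arc.

-- Revealing an arc v → w, with t the start of the path ending at v, prepends that path to the one
-- starting at w. So the vertex x with start w now has start t.
redirect : ∀ {n} → (Fin n → Fin n) → Fin n → Fin n → (Fin n → Fin n)
redirect s w t x = if ⌊ s x ≟ w ⌋ then t else s x

redirect-hit : ∀ {n} (s : Fin n → Fin n) w t x → s x ≡ w → redirect s w t x ≡ t
redirect-hit s w t x eq with s x ≟ w
... | yes _ = refl
... | no ¬p = ⊥-elim (¬p eq)

redirect-miss : ∀ {n} (s : Fin n → Fin n) w t x → s x ≢ w → redirect s w t x ≡ s x
redirect-miss s w t x neq with s x ≟ w
... | yes p = ⊥-elim (neq p)
... | no  _ = refl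

-- Reveal f v for the vertices v in the given order. The revealed arcs form paths and cycles, and
-- s v is the start of the revealed path that ends at the unrevealed vertex v; so v closes a cycle
-- exactly when f v = s v.
closing : ∀ {n} → List (Fin n) → (Fin n → Fin n) → (Fin n → Fin n) → List (Fin n)
closing []      s f = []
closing (v ∷ τ) s f = if ⌊ f v ≟ s v ⌋ then v ∷ rest else rest
  where rest = closing τ (redirect s (f v) (s v)) f

module _ {n : ℕ} (σ : Vec (Fin n) n) (inj : Injective _≡_ _≡_ (lookupᵥ σ)) where
  open Orbits σ inj

  private
    f = lookupᵥ σ

  -- The invariants say that for unrevealed x the value `f x` starts the path of some unrevealed y,
  -- and that y is reached from `s y`. If v does not close its cycle, the arc from v enters the path
  -- of another unrevealed vertex on the same cycle, and the induction applies to that vertex.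
  reaches-closing : ∀ τ s → Unique τ → (∀ {x} → x ∈ τ → ∃[ y ] y ∈ τ × s y ≡ f x) →
                    (∀ {y} → y ∈ τ → Reaches (s y) y) →
                    ∀ {x} → x ∈ τ → ∃[ v ] v ∈ closing τ s f × Reaches x v
  reaches-closing (v ∷ τ) s (v∉τ ∷ uniq) start path = result
    where
    s′ = redirect s (f v) (s v)
    distinct : ∀ {x} → x ∈ τ → f x ≢ f v
    distinct x∈τ eq = All.lookup v∉τ x∈τ (sym (inj eq))
    start′ : ∀ {x} → x ∈ τ → ∃[ y ] y ∈ τ × s′ y ≡ f x
    start′ x∈τ with start (there x∈τ)
    ... | y , there y∈τ , eq = y , y∈τ ,
      trans (redirect-miss s (f v) (s v) y (λ hit → distinct x∈τ (trans (sym eq) hit))) eq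
    -- The path starting at `f x` ends at v. The new arc continues it into the path starting at
    -- `f v`, whose end y inherits the start `f x`.
    ... | .v , here refl , eq with start (here refl)
    ...   | y , there y∈τ , eq′ = y , y∈τ , trans (redirect-hit s (f v) (s v) y eq′) eq
    ...   | .v , here refl , eq′ = ⊥-elim (distinct x∈τ (trans (sym eq) eq′))
    path′ : ∀ {y} → y ∈ τ → Reaches (s′ y) y
    path′ {y} y∈τ with s y ≟ f v
    ... | no  _   = path (there y∈τ)
    ... | yes hit = reaches-trans {s v} {v} {y} (path (here refl)) (reaches-trans {v} {s y} {y} (1 , sym hit) (path (there y∈τ)))
    later : ∀ {x} → x ∈ τ → ∃[ w ] w ∈ closing τ s′ f × Reaches x w
    later = reaches-closing τ s′ uniq start′ path′
    result : ∀ {x} → x ∈ v ∷ τ → ∃[ w ] w ∈ closing (v ∷ τ) s f × Reaches x w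
    result x∈ with f v ≟ s v
    result (here refl) | yes _ = v , here refl , 0 , refl
    result (there x∈τ) | yes _ = let w , w∈ , r = later x∈τ in w , there w∈ , r
    result (there x∈τ) | no  _ = later x∈τ
    result (here refl) | no ¬closes with start (here refl)
    ... | .v , here refl , eq = ⊥-elim (¬closes (sym eq))
    ... | y , there y∈τ , eq with w , w∈ , r ← later y∈τ =
      w , w∈ , reaches-trans {v} {y} {w} (reaches-trans {v} {s y} {y} (1 , sym eq) (path (there y∈τ))) r

  -- Each cycle minimum reaches a closing vertex. Minima that reach the same one lie on one cycle,
  -- where each is at most the other.
  numCycles≤closing : ∀ τ → Unique τ → (∀ x → x ∈ τ) → numCycles σ ≤ length (closing τ id f)
  numCycles≤closing τ uniq all∈ = ≤-trans (≤-reflexive (sym (filterB-length (isCycleMin σ) (allFin n))))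
    (length-injection Reaches (filterB-unique (allFin⁺ n))
      (λ {x} _ → reaches-closing τ id uniq (λ {x} _ → f x , all∈ (f x) , refl) (λ _ → 0 , refl) (all∈ x))
      (λ {x} {x′} {v} x∈ x′∈ r r′ → toℕ-injective (≤-antisym
        (cycleMin-≤ (proj₂ (filterB-∈⁻ (allFin n) x∈)) (reaches-trans {x} {v} {x′} r (reaches-sym {x′} {v} r′)))
        (cycleMin-≤ (proj₂ (filterB-∈⁻ (allFin n) x′∈)) (reaches-trans {x′} {v} {x} r′ (reaches-sym {x} {v} r))))))

-- Total weight of the cycle-factors revealed along a fixed order.

lookupᵥ-injective : {A : Set} {n : ℕ} {xs ys : Vec A n} → (∀ i → lookupᵥ xs i ≡ lookupᵥ ys i) → xs ≡ ys
lookupᵥ-injective {xs = xs} {ys} h = trans (sym (tabulate∘lookup xs)) (trans (tabulate-cong h) (tabulate∘lookup ys))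

≟-elim : ∀ {n} {x y : Fin n} → ⌊ x ≟ y ⌋ ≡ true → x ≡ y
≟-elim {x = x} {y} h with x ≟ y
... | yes p = p

-- Revealing f along τ, the vertex v has as many admissible values as there are u at or after v with
-- an edge from v to f u; y assigns a weight to that number.
module Exposure {n d : ℕ} (G : Digraph n) (reg : Regular d G) (y : ℕ → ℕ) where

  options : Fin n → List (Fin n) → (Fin n → Fin n) → ℕ
  options v τ f = ∑ τ (λ u → 𝟙 (G v (f u)))

  optionWeight : List (Fin n) → (Fin n → Fin n) → ℕ
  optionWeight []      f = 1
  optionWeight (v ∷ τ) f = y (options v (v ∷ τ) f) * optionWeight τ f

  bonus : Bool → ℕ
  bonus b = if b then 2 else 1

  pathWeight : List (Fin n) → (Fin n → Fin n) → (Fin n → Fin n) → ℕ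
  pathWeight []      s f = 1
  pathWeight (v ∷ τ) s f =
    bonus ⌊ f v ≟ s v ⌋ * y (options v (v ∷ τ) f) * pathWeight τ (redirect s (f v) (s v)) f

  pathWeight-closing : ∀ τ s f → pathWeight τ s f ≡ 2 ^ length (closing τ s f) * optionWeight τ f
  pathWeight-closing []      s f = refl
  pathWeight-closing (v ∷ τ) s f
    rewrite pathWeight-closing τ (redirect s (f v) (s v)) f with f v ≟ s v
  ... | yes _ = regroup 2 (y _) (2 ^ length (closing τ (redirect s (f v) (s v)) f)) (optionWeight τ f)
    where
    regroup : ∀ a b c d → a * b * (c * d) ≡ a * c * (b * d)
    regroup = solve-∀
  ... | no  _ = regroup (y _) (2 ^ length (closing τ (redirect s (f v) (s v)) f)) (optionWeight τ f)
    where
    regroup : ∀ b c d → 1 * b * (c * d) ≡ c * (b * d)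
    regroup = solve-∀

  module _ (F : ℕ) (y-bound : ∀ k → k ≤ d → suc k * y k ≤ F) where

    options-sum : ∀ v (s : Fin n) (R : Fin n → Bool) Y → let k = ∑ (allFin n) (λ w → 𝟙 (R w) * 𝟙 (G v w)) in
      ∑ (allFin n) (λ w → 𝟙 (R w) * 𝟙 (G v w) * (bonus ⌊ w ≟ s ⌋ * Y)) ≤ suc k * Y
    options-sum v s R Y = begin
      ∑ (allFin n) (λ w → 𝟙 (R w) * 𝟙 (G v w) * (bonus ⌊ w ≟ s ⌋ * Y))
        ≤⟨ ∑-mono (allFin n) (λ {w} _ → bound w) ⟩
      ∑ (allFin n) (λ w → (𝟙 (R w) * 𝟙 (G v w) + (if ⌊ w ≟ s ⌋ then 1 else 0)) * Y)
        ≡⟨ ∑-*ʳ Y (allFin n) _ ⟩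
      ∑ (allFin n) (λ w → 𝟙 (R w) * 𝟙 (G v w) + (if ⌊ w ≟ s ⌋ then 1 else 0)) * Y
        ≡⟨ cong (_* Y) (trans (∑-+ (allFin n) _ _) (trans (cong (k +_) (∑-δ s (λ _ → 1))) (+-comm k 1))) ⟩
      suc k * Y ∎
      where
      open ≤-Reasoning
      k = ∑ (allFin n) (λ w → 𝟙 (R w) * 𝟙 (G v w))
      bound : ∀ w → 𝟙 (R w) * 𝟙 (G v w) * (bonus ⌊ w ≟ s ⌋ * Y) ≤ (𝟙 (R w) * 𝟙 (G v w) + (if ⌊ w ≟ s ⌋ then 1 else 0)) * Y
      bound w with R w | G v w | w ≟ s
      ... | true  | true  | yes _ = ≤-reflexive (+-identityʳ _)
      ... | true  | true  | no  _ = ≤-reflexive (+-identityʳ _)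
      ... | true  | false | _     = z≤n
      ... | false | _     | _     = z≤n

    options-≤d : ∀ v (R : Fin n → Bool) → ∑ (allFin n) (λ w → 𝟙 (R w) * 𝟙 (G v w)) ≤ d
    options-≤d v R = ≤-trans (∑-mono (allFin n) (λ {w} _ → drop (R w) (𝟙 (G v w)))) (≤-reflexive (proj₁ (reg v)))
      where
      drop : (b : Bool) (x : ℕ) → 𝟙 b * x ≤ x
      drop true  x = ≤-reflexive (+-identityʳ x)
      drop false x = z≤n

    exposure-bound : ∀ τ s (R : Fin n → Bool) (L : List (Vec (Fin n) n)) → Unique L →
      (∀ {σ σ′} → σ ∈ L → σ′ ∈ L → ∀ x → x ∉ τ → lookupᵥ σ x ≡ lookupᵥ σ′ x) →
      (∀ {σ} → σ ∈ L → ∀ x → G x (lookupᵥ σ x) ≡ true) →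
      (∀ {σ} → σ ∈ L → ∀ h → ∑ τ (h ∘ lookupᵥ σ) ≡ ∑ (allFin n) (λ w → 𝟙 (R w) * h w)) →
      ∑ L (λ σ → pathWeight τ s (lookupᵥ σ)) ≤ F ^ length τ
    exposure-bound [] s R []           uniq agree edge unused = z≤n
    exposure-bound [] s R (σ ∷ [])     uniq agree edge unused = ≤-refl
    exposure-bound [] s R (σ ∷ σ′ ∷ L) ((σ≢σ′ ∷ _) ∷ _) agree edge unused =
      ⊥-elim (σ≢σ′ (lookupᵥ-injective (λ x → agree (here refl) (there (here refl)) x (λ ()))))
    exposure-bound (v ∷ τ) s R L uniq agree edge unused = begin
      ∑ L (λ σ → pathWeight (v ∷ τ) s (lookupᵥ σ))
        ≡⟨ ∑-cong L (λ σ → sym (∑-δ′ (lookupᵥ σ v) (λ _ → pathWeight (v ∷ τ) s (lookupᵥ σ)))) ⟩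
      ∑ L (λ σ → ∑ (allFin n) (λ w → if ⌊ lookupᵥ σ v ≟ w ⌋ then pathWeight (v ∷ τ) s (lookupᵥ σ) else 0))
        ≡⟨ ∑-swap L (allFin n) _ ⟩
      ∑ (allFin n) (λ w → ∑ L (λ σ → if ⌊ lookupᵥ σ v ≟ w ⌋ then pathWeight (v ∷ τ) s (lookupᵥ σ) else 0))
        ≡⟨ ∑-cong (allFin n) (λ w → sym (∑-filterB (λ σ → ⌊ lookupᵥ σ v ≟ w ⌋) L _)) ⟩
      ∑ (allFin n) (λ w → ∑ (class w) (λ σ → pathWeight (v ∷ τ) s (lookupᵥ σ)))
        ≤⟨ ∑-mono (allFin n) (λ {w} _ → class-bound w (class w) refl) ⟩
      ∑ (allFin n) (λ w → 𝟙 (R w) * 𝟙 (G v w) * (bonus ⌊ w ≟ s v ⌋ * (y k * F ^ length τ)))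
        ≤⟨ options-sum v (s v) R (y k * F ^ length τ) ⟩
      suc k * (y k * F ^ length τ)
        ≡⟨ *-assoc (suc k) (y k) _ ⟨
      suc k * y k * F ^ length τ
        ≤⟨ *-monoˡ-≤ (F ^ length τ) (y-bound k (options-≤d v R)) ⟩
      F * F ^ length τ ∎
      where
      open ≤-Reasoning
      k = ∑ (allFin n) (λ w → 𝟙 (R w) * 𝟙 (G v w))
      class : Fin n → List (Vec (Fin n) n)
      class w = filterB (λ σ → ⌊ lookupᵥ σ v ≟ w ⌋) L
      class-∈ : ∀ {w σ} → σ ∈ class w → σ ∈ L × lookupᵥ σ v ≡ w
      class-∈ σ∈ = let σ∈L , eq = filterB-∈⁻ L σ∈ in σ∈L , ≟-elim eq
      available : ∀ {w σ} → σ ∈ class w → R w ≡ true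
      available {w} {σ} σ∈ with class-∈ σ∈
      ... | σ∈L , refl with R (lookupᵥ σ v) in Rw
      ...   | true  = refl
      ...   | false = ⊥-elim (<⇒≱ positive (≤-reflexive (trans (unused σ∈L indicator) none)))
        where
        indicator : Fin n → ℕ
        indicator u = if ⌊ u ≟ lookupᵥ σ v ⌋ then 1 else 0
        positive : 0 < ∑ (v ∷ τ) (indicator ∘ lookupᵥ σ)
        positive with lookupᵥ σ v ≟ lookupᵥ σ v
        ... | yes _ = s≤s z≤n
        ... | no ¬p = ⊥-elim (¬p refl)
        none : ∑ (allFin n) (λ u → 𝟙 (R u) * indicator u) ≡ 0
        none = trans (∑-cong (allFin n) vanish) (∑-0 (allFin n))
          where
          vanish : ∀ u → 𝟙 (R u) * indicator u ≡ 0
          vanish u with u ≟ lookupᵥ σ v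
          ... | yes refl rewrite Rw = refl
          ... | no  _    = *-zeroʳ (𝟙 (R u))
      class-bound : ∀ w K → K ≡ class w → ∑ K (λ σ → pathWeight (v ∷ τ) s (lookupᵥ σ))
                    ≤ 𝟙 (R w) * 𝟙 (G v w) * (bonus ⌊ w ≟ s v ⌋ * (y k * F ^ length τ))
      class-bound w []      K≡ = z≤n
      class-bound w K@(σ₀ ∷ _) K≡ = begin
        ∑ K (λ σ → pathWeight (v ∷ τ) s (lookupᵥ σ))
          ≡⟨ ∑-cong∈ K same ⟩
        ∑ K (λ σ → bonus ⌊ w ≟ s v ⌋ * y k * pathWeight τ s′ (lookupᵥ σ))
          ≡⟨ ∑-*ˡ (bonus ⌊ w ≟ s v ⌋ * y k) K _ ⟩
        bonus ⌊ w ≟ s v ⌋ * y k * ∑ K (λ σ → pathWeight τ s′ (lookupᵥ σ))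
          ≤⟨ *-monoʳ-≤ (bonus ⌊ w ≟ s v ⌋ * y k) induction ⟩
        bonus ⌊ w ≟ s v ⌋ * y k * F ^ length τ
          ≡⟨ trans (*-assoc (bonus ⌊ w ≟ s v ⌋) (y k) _) (sym (*-identityˡ _)) ⟩
        1 * (bonus ⌊ w ≟ s v ⌋ * (y k * F ^ length τ))
          ≡⟨ cong₂ (λ b c → 𝟙 b * 𝟙 c * (bonus ⌊ w ≟ s v ⌋ * (y k * F ^ length τ))) Rw Gvw ⟨
        𝟙 (R w) * 𝟙 (G v w) * (bonus ⌊ w ≟ s v ⌋ * (y k * F ^ length τ)) ∎
        where
        s′ = redirect s w (s v)
        K∈ : ∀ {σ} → σ ∈ K → σ ∈ class w
        K∈ = subst (_ ∈_) K≡
        Rw : R w ≡ true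
        Rw = available (K∈ (here refl))
        Gvw : G v w ≡ true
        Gvw = let σ∈L , eq = class-∈ (K∈ (here refl)) in subst (λ z → G v z ≡ true) eq (edge σ∈L v)
        same : ∀ {σ} → σ ∈ K → pathWeight (v ∷ τ) s (lookupᵥ σ) ≡ bonus ⌊ w ≟ s v ⌋ * y k * pathWeight τ s′ (lookupᵥ σ)
        same {σ} σ∈ = let σ∈L , eq = class-∈ (K∈ σ∈) in
          cong₂ (λ z j → bonus ⌊ z ≟ s v ⌋ * y j * pathWeight τ (redirect s z (s v)) (lookupᵥ σ)) eq
            (unused σ∈L (λ u → 𝟙 (G v u)))
        induction : ∑ K (λ σ → pathWeight τ s′ (lookupᵥ σ)) ≤ F ^ length τ
        induction = exposure-bound τ s′ (R ∖ w) K (subst Unique (sym K≡) (filterB-unique uniq)) agree′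
          (λ σ∈ → edge (proj₁ (class-∈ (K∈ σ∈)))) unused′
          where
          agree′ : ∀ {σ σ′} → σ ∈ K → σ′ ∈ K → ∀ x → x ∉ τ → lookupᵥ σ x ≡ lookupᵥ σ′ x
          agree′ σ∈ σ′∈ x x∉ with x ≟ v
          ... | yes refl = trans (proj₂ (class-∈ (K∈ σ∈))) (sym (proj₂ (class-∈ (K∈ σ′∈))))
          ... | no  x≢v  = agree (proj₁ (class-∈ (K∈ σ∈))) (proj₁ (class-∈ (K∈ σ′∈))) x
                             (λ { (here p) → x≢v p ; (there x∈) → x∉ x∈ })
          unused′ : ∀ {σ} → σ ∈ K → ∀ h → ∑ τ (h ∘ lookupᵥ σ) ≡ ∑ (allFin n) (λ u → 𝟙 ((R ∖ w) u) * h u)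
          unused′ {σ} σ∈ h = +-cancelˡ-≡ (h w) _ _ (begin-equality
            h w + ∑ τ (h ∘ lookupᵥ σ)
              ≡⟨ cong (λ z → h z + ∑ τ (h ∘ lookupᵥ σ)) (proj₂ (class-∈ (K∈ σ∈))) ⟨
            h (lookupᵥ σ v) + ∑ τ (h ∘ lookupᵥ σ)
              ≡⟨ unused (proj₁ (class-∈ (K∈ σ∈))) h ⟩
            ∑ (allFin n) (λ u → 𝟙 (R u) * h u)
              ≡⟨ ∑-remove R w Rw h ⟩
            h w + ∑ (allFin n) (λ u → 𝟙 ((R ∖ w) u) * h u) ∎)

-- Vertex orders and their relabelling.

allVecs-product : ∀ n k → allVecs n (suc k) ≡ cartesianProductWith _∷ᵥ_ (allFin n) (allVecs n k)
allVecs-product n k = go (allFin n)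
  where
  go : ∀ is → concatMap (λ i → map (i ∷ᵥ_) (allVecs n k)) is ≡ cartesianProductWith _∷ᵥ_ is (allVecs n k)
  go []       = refl
  go (i ∷ is) = cong (map (i ∷ᵥ_) (allVecs n k) ++_) (go is)

allVecs-unique : ∀ n k → Unique (allVecs n k)
allVecs-unique n zero    = [] ∷ []
allVecs-unique n (suc k) = subst Unique (sym (allVecs-product n k))
  (cartesianProductWith⁺ _∷ᵥ_ ∷ᵥ-injective (allFin⁺ n) (allVecs-unique n k))

∈-allVecs : ∀ {n k} (σ : Vec (Fin n) k) → σ ∈ allVecs n k
∈-allVecs {n} []ᵥ              = here refl
∈-allVecs {n} {suc k} (i ∷ᵥ σ) = subst (i ∷ᵥ σ ∈_) (sym (allVecs-product n k))
  (∈-cartesianProductWith⁺ _∷ᵥ_ (∈-allFin i) (∈-allVecs σ))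

∏-allVecs-map : ∀ {n} {g : Fin n → Fin n} → Injective _≡_ _≡_ g → ∀ k (h : Vec (Fin n) k → ℕ) →
                ∏ (allVecs n k) (h ∘ mapᵥ g) ≡ ∏ (allVecs n k) h
∏-allVecs-map         inj zero    h = refl
∏-allVecs-map {n} {g} inj (suc k) h = begin
  ∏ (allVecs n (suc k)) (h ∘ mapᵥ g)
    ≡⟨ first (h ∘ mapᵥ g) ⟩
  ∏ (allFin n) (λ i → ∏ (allVecs n k) (λ σ → h (g i ∷ᵥ mapᵥ g σ)))
    ≡⟨ ∏-cong (allFin n) (λ i → ∏-allVecs-map inj k (λ σ → h (g i ∷ᵥ σ))) ⟩
  ∏ (allFin n) (λ i → ∏ (allVecs n k) (λ σ → h (g i ∷ᵥ σ)))
    ≡⟨ ∏-reindex inj (injective⇒surjective inj) (λ i → ∏ (allVecs n k) (λ σ → h (i ∷ᵥ σ))) ⟩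
  ∏ (allFin n) (λ i → ∏ (allVecs n k) (λ σ → h (i ∷ᵥ σ)))
    ≡⟨ first h ⟨
  ∏ (allVecs n (suc k)) h ∎
  where
  open ≡-Reasoning
  first : ∀ h → ∏ (allVecs n (suc k)) h ≡ ∏ (allFin n) (λ i → ∏ (allVecs n k) (λ σ → h (i ∷ᵥ σ)))
  first h = trans (∏-concatMap (λ i → map (i ∷ᵥ_) (allVecs n k)) (allFin n) h)
                  (∏-cong (allFin n) (λ i → ∏-map (i ∷ᵥ_) (allVecs n k) h))

transpose-injective : ∀ {n} (i j : Fin n) → Injective _≡_ _≡_ (transpose i j)
transpose-injective i j {x} {y} eq =
  trans (sym (transpose-inverse j i)) (trans (cong (transpose j i) eq) (transpose-inverse j i))

transpose-left : ∀ {n} (i j : Fin n) → transpose i j i ≡ j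
transpose-left i j rewrite dec-true (i ≟ i) refl = refl

transpose-invariant : ∀ {n} {A : Set} (D : Fin n → A) i j → D i ≡ D j → ∀ k → D (transpose i j k) ≡ D k
transpose-invariant D i j eq k with k ≟ i
... | yes refl = sym eq
... | no  _ with k ≟ j
...   | yes refl = eq
...   | no  _    = refl

bool-ext : ∀ {a b} → (a ≡ true → b ≡ true) → (b ≡ true → a ≡ true) → a ≡ b
bool-ext {false} {false} f g = refl
bool-ext {false} {true}  f g = g refl
bool-ext {true}          f g = sym (f refl)

orders : ∀ n → List (Vec (Fin n) n)
orders n = filterB isInjective (allVecs n n)

order : ∀ {n} → Vec (Fin n) n → List (Fin n)
order {n} τ = map (lookupᵥ τ) (allFin n)

module _ {n : ℕ} where

  order-map : (g : Fin n → Fin n) (τ : Vec (Fin n) n) → order (mapᵥ g τ) ≡ map g (order τ)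
  order-map g τ = trans (map-cong (λ i → lookup-map i g τ) (allFin n)) (map-∘ (allFin n))

  isInjective-map : {g : Fin n → Fin n} → Injective _≡_ _≡_ g → ∀ τ → isInjective (mapᵥ g τ) ≡ isInjective τ
  isInjective-map {g} inj τ = bool-ext
    (λ h → isInjective-intro τ (λ {i} {j} eq → isInjective-elim (mapᵥ g τ) h
      (trans (lookup-map i g τ) (trans (cong g eq) (sym (lookup-map j g τ))))))
    (λ h → isInjective-intro (mapᵥ g τ) (λ {i} {j} eq → isInjective-elim τ h
      (inj (trans (sym (lookup-map i g τ)) (trans eq (lookup-map j g τ))))))

  -- An injective relabelling permutes all vectors and preserves injectivity, hence permutes the
  -- orders.
  ∏-orders-map : {g : Fin n → Fin n} → Injective _≡_ _≡_ g → (h : List (Fin n) → ℕ) →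
                 ∏ (orders n) (λ τ → h (map g (order τ))) ≡ ∏ (orders n) (h ∘ order)
  ∏-orders-map {g} inj h = begin
    ∏ (orders n) (λ τ → h (map g (order τ)))
      ≡⟨ ∏-filterB isInjective (allVecs n n) _ ⟩
    ∏ (allVecs n n) (λ τ → if isInjective τ then h (map g (order τ)) else 1)
      ≡⟨ ∏-cong (allVecs n n) (λ τ → cong₂ (λ b o → if b then h o else 1) (sym (isInjective-map inj τ)) (sym (order-map g τ))) ⟩
    ∏ (allVecs n n) (λ τ → if isInjective (mapᵥ g τ) then h (order (mapᵥ g τ)) else 1)
      ≡⟨ ∏-allVecs-map inj n (λ τ → if isInjective τ then h (order τ) else 1) ⟩
    ∏ (allVecs n n) (λ τ → if isInjective τ then h (order τ) else 1)
      ≡⟨ ∏-filterB isInjective (allVecs n n) _ ⟨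
    ∏ (orders n) (h ∘ order) ∎
    where open ≡-Reasoning

  orders-injective : ∀ {τ} → τ ∈ orders n → Injective _≡_ _≡_ (lookupᵥ τ)
  orders-injective {τ} τ∈ = isInjective-elim τ (proj₂ (filterB-∈⁻ (allVecs n n) τ∈))

  orders-nonempty : 1 ≤ length (orders n)
  orders-nonempty = nonempty (filterB-∈⁺ {p = isInjective} (allVecs n n) (∈-allVecs (tabulateᵥ id))
    (isInjective-intro {n} (tabulateᵥ id) (λ {i} {j} eq →
      trans (sym (lookup∘tabulate id i)) (trans eq (lookup∘tabulate id j)))))
    where
    nonempty : ∀ {A : Set} {x : A} {xs} → x ∈ xs → 1 ≤ length xs
    nonempty (here _)  = s≤s z≤n
    nonempty (there _) = s≤s z≤n

  ∑-order : ∀ {τ} → τ ∈ orders n → (h : Fin n → ℕ) → ∑ (order τ) h ≡ ∑ (allFin n) h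
  ∑-order {τ} τ∈ h = trans (∑-map (lookupᵥ τ) (allFin n) h)
    (∑-reindex (orders-injective τ∈) (injective⇒surjective (orders-injective τ∈)) h)

  order-unique : ∀ {τ} → τ ∈ orders n → Unique (order τ)
  order-unique τ∈ = unique-map⁺ (orders-injective τ∈) (allFin⁺ n)

  order-complete : ∀ {τ} → τ ∈ orders n → ∀ x → x ∈ order τ
  order-complete {τ} τ∈ x with i , eq ← injective⇒surjective (orders-injective τ∈) x =
    subst (_∈ order τ) eq (∈-map⁺ (lookupᵥ τ) (∈-allFin i))

-- The average over all orders.

module Averaging {n : ℕ} (y : ℕ → ℕ) where

  yProduct : ℕ → ℕ
  yProduct zero    = 1
  yProduct (suc k) = y (suc k) * yProduct k

  -- Only the position of v contributes: for duplicate-free τ the value is y of the number of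
  -- elements of D at or after v, and 1 if v is absent. The product form makes the weights of
  -- different v multiply along τ.
  rankWeight : (Fin n → Bool) → Fin n → List (Fin n) → ℕ
  rankWeight D v []      = 1
  rankWeight D v (x ∷ τ) = (if ⌊ x ≟ v ⌋ then y (∑ (x ∷ τ) (λ u → 𝟙 (D u))) else 1) * rankWeight D v τ

  rankWeight-map : ∀ D {g} → Injective _≡_ _≡_ g → (∀ u → D (g u) ≡ D u) →
                   ∀ v τ → rankWeight D (g v) (map g τ) ≡ rankWeight D v τ
  rankWeight-map D {g} inj inv v []      = refl
  rankWeight-map D {g} inj inv v (x ∷ τ) =
    cong₂ _*_ (cong₂ (λ b k → if b then y k else 1) same-test same-count) (rankWeight-map D inj inv v τ)
    where
    same-test : ⌊ g x ≟ g v ⌋ ≡ ⌊ x ≟ v ⌋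
    same-test with g x ≟ g v | x ≟ v
    ... | yes _ | yes _ = refl
    ... | no  _ | no  _ = refl
    ... | yes p | no ¬q = ⊥-elim (¬q (inj p))
    ... | no ¬p | yes q = ⊥-elim (¬p (cong g q))
    same-count : ∑ (g x ∷ map g τ) (λ u → 𝟙 (D u)) ≡ ∑ (x ∷ τ) (λ u → 𝟙 (D u))
    same-count = trans (∑-map g (x ∷ τ) (λ u → 𝟙 (D u))) (∑-cong (x ∷ τ) (λ u → cong 𝟙 (inv u)))

  -- Along any order the elements of D have ranks |D|, …, 1.
  ∏-rankWeight : ∀ D τ → ∏ (allFin n) (λ u → if D u then rankWeight D u τ else 1) ≡ yProduct (∑ τ (λ u → 𝟙 (D u)))
  ∏-rankWeight D []      = trans (∏-cong (allFin n) (λ u → const1 (D u))) (∏-1 (allFin n))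
    where
    const1 : ∀ b → (if b then 1 else 1) ≡ 1
    const1 true  = refl
    const1 false = refl
  ∏-rankWeight D (x ∷ τ) = begin
    ∏ (allFin n) (λ u → if D u then rankWeight D u (x ∷ τ) else 1)
      ≡⟨ ∏-cong (allFin n) split ⟩
    ∏ (allFin n) (λ u → (if ⌊ x ≟ u ⌋ then (if D u then y count else 1) else 1) * (if D u then rankWeight D u τ else 1))
      ≡⟨ ∏-* (allFin n) (λ u → if ⌊ x ≟ u ⌋ then (if D u then y count else 1) else 1) (λ u → if D u then rankWeight D u τ else 1) ⟩
    ∏ (allFin n) (λ u → if ⌊ x ≟ u ⌋ then (if D u then y count else 1) else 1) * ∏ (allFin n) (λ u → if D u then rankWeight D u τ else 1)
      ≡⟨ cong₂ _*_ (∏-δ′ x (λ u → if D u then y count else 1)) (∏-rankWeight D τ) ⟩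
    (if D x then y count else 1) * yProduct (∑ τ (λ u → 𝟙 (D u)))
      ≡⟨ combine ⟩
    yProduct count ∎
    where
    open ≡-Reasoning
    count = ∑ (x ∷ τ) (λ u → 𝟙 (D u))
    split : ∀ u → (if D u then rankWeight D u (x ∷ τ) else 1)
                ≡ (if ⌊ x ≟ u ⌋ then (if D u then y count else 1) else 1) * (if D u then rankWeight D u τ else 1)
    split u with D u | ⌊ x ≟ u ⌋
    ... | true  | true  = refl
    ... | true  | false = refl
    ... | false | true  = refl
    ... | false | false = refl
    combine : (if D x then y count else 1) * yProduct (∑ τ (λ u → 𝟙 (D u))) ≡ yProduct count
    combine with D x
    ... | true  = refl
    ... | false = +-identityʳ _

  -- The orders are invariant under transposing two elements of D, so all elements of D are equally
  -- likely to have a given rank.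
  rankWeight-average : ∀ D d → ∑ (allFin n) (λ u → 𝟙 (D u)) ≡ d → ∀ v → D v ≡ true →
    ∏ (orders n) (λ τ → rankWeight D v (order τ)) ^ d ≡ yProduct d ^ length (orders n)
  rankWeight-average D d size v Dv = begin
    B v ^ d
      ≡⟨ cong (B v ^_) size ⟨
    B v ^ ∑ (allFin n) (λ u → 𝟙 (D u))
      ≡⟨ ∏-if (allFin n) D (B v) ⟨
    ∏ (allFin n) (λ u → if D u then B v else 1)
      ≡⟨ ∏-cong (allFin n) symmetric ⟩
    ∏ (allFin n) (λ u → ∏ (orders n) (λ τ → if D u then rankWeight D u (order τ) else 1))
      ≡⟨ ∏-swap (allFin n) (orders n) _ ⟩
    ∏ (orders n) (λ τ → ∏ (allFin n) (λ u → if D u then rankWeight D u (order τ) else 1))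
      ≡⟨ ∏-cong∈ (orders n) (λ {τ} τ∈ → trans (∏-rankWeight D (order τ)) (cong yProduct (trans (∑-order τ∈ (λ u → 𝟙 (D u))) size))) ⟩
    ∏ (orders n) (λ _ → yProduct d)
      ≡⟨ ∏-const (yProduct d) (orders n) ⟩
    yProduct d ^ length (orders n) ∎
    where
    open ≡-Reasoning
    B : Fin n → ℕ
    B u = ∏ (orders n) (λ τ → rankWeight D u (order τ))
    symmetric : ∀ u → (if D u then B v else 1) ≡ ∏ (orders n) (λ τ → if D u then rankWeight D u (order τ) else 1)
    symmetric u with D u in Du
    ... | false = sym (∏-1 (orders n))
    ... | true  = begin
      B v
        ≡⟨ ∏-cong (orders n) (λ τ → rankWeight-map D inj inv v (order τ)) ⟨
      ∏ (orders n) (λ τ → rankWeight D (transpose v u v) (map (transpose v u) (order τ)))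
        ≡⟨ ∏-orders-map inj (rankWeight D (transpose v u v)) ⟩
      B (transpose v u v)
        ≡⟨ cong B (transpose-left v u) ⟩
      B u ∎
      where
      inj = transpose-injective v u
      inv = transpose-invariant D v u (trans Dv (sym Du))

argmin : {A : Set} (x : A) (xs : List A) (f : A → ℕ) → ∃[ m ] m ∈ x ∷ xs × (∀ {z} → z ∈ x ∷ xs → f m ≤ f z)
argmin x []        f = x , here refl , λ { (here refl) → ≤-refl }
argmin x (x′ ∷ xs) f with argmin x′ xs f
... | m , m∈ , min with ≤-total (f x) (f m)
...   | inj₁ x≤m = x , here refl , λ { (here refl) → ≤-refl ; (there z∈) → ≤-trans x≤m (min z∈) }
...   | inj₂ m≤x = m , there m∈ , λ { (here refl) → m≤x ; (there z∈) → min z∈ }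

-- K may have no integer d-th root to pull out of the sum, so the least `q x` takes its place.
weighted-sum-power : {A : Set} (d : ℕ) .⦃ _ : NonZero d ⦄ (K : ℕ) (xs : List A) (w q : A → ℕ) →
                     (∀ {x} → x ∈ xs → K ≤ q x ^ d) → ∑ xs w ^ d * K ≤ ∑ xs (λ x → w x * q x) ^ d
weighted-sum-power (suc d) K []       w q h = z≤n
weighted-sum-power d       K (x ∷ xs) w q h with m , m∈ , min ← argmin x xs q = begin
  ∑ (x ∷ xs) w ^ d * K                      ≤⟨ *-monoʳ-≤ (∑ (x ∷ xs) w ^ d) (h m∈) ⟩
  ∑ (x ∷ xs) w ^ d * q m ^ d                ≡⟨ ^-distribʳ-* (∑ (x ∷ xs) w) (q m) d ⟨
  (∑ (x ∷ xs) w * q m) ^ d                  ≡⟨ cong (_^ d) (∑-*ʳ (q m) (x ∷ xs) w) ⟨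
  ∑ (x ∷ xs) (λ z → w z * q m) ^ d          ≤⟨ ^-monoˡ-≤ d (∑-mono (x ∷ xs) (λ {z} z∈ → *-monoʳ-≤ (w z) (min z∈))) ⟩
  ∑ (x ∷ xs) (λ z → w z * q z) ^ d          ∎
  where open ≤-Reasoning

-- The upper bound for the sum of 2^cycles.

module UpperBound {n d : ℕ} .⦃ _ : NonZero d ⦄ (G : Digraph n) (reg : Regular d G) where

  F : ℕ
  F = suc d !

  -- An integer version of 1/(k+1): F = (d+1)! is divisible by every `suc k` with k ≤ d, so the
  -- division is exact there.
  y : ℕ → ℕ
  y k = F / suc k

  instance
    F≢0 : NonZero F
    F≢0 = suc d !≢0

  y-exact : ∀ k → k ≤ d → suc k * y k ≡ F
  y-exact k k≤d = trans (*-comm (suc k) (y k))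
    (m/n*n≡m (∣-trans (m∣m*n (k !)) (m≤n⇒m!∣n! (s≤s k≤d))))

  open Exposure G reg y
  open Averaging {n} y

  yProduct-exact : ∀ k → k ≤ d → suc k ! * yProduct k ≡ F ^ k
  yProduct-exact zero    k≤d = refl
  yProduct-exact (suc k) k<d = begin
    suc (suc k) * suc k ! * (y (suc k) * yProduct k)
      ≡⟨ [m*n]*[o*p]≡[m*o]*[n*p] (suc (suc k)) (suc k !) (y (suc k)) (yProduct k) ⟩
    suc (suc k) * y (suc k) * (suc k ! * yProduct k)
      ≡⟨ cong₂ _*_ (y-exact (suc k) k<d) (yProduct-exact k (<⇒≤ k<d)) ⟩
    F ^ suc k ∎
    where open ≡-Reasoning

  optionWeight-rank : ∀ τ f → optionWeight τ f ≡ ∏ (allFin n) (λ v → rankWeight (λ u → G v (f u)) v τ)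
  optionWeight-rank []      f = sym (∏-1 (allFin n))
  optionWeight-rank (x ∷ τ) f = begin
    y (options x (x ∷ τ) f) * optionWeight τ f
      ≡⟨ cong₂ _*_ (sym (∏-δ′ x (λ v → y (options v (x ∷ τ) f)))) (optionWeight-rank τ f) ⟩
    ∏ (allFin n) (λ v → if ⌊ x ≟ v ⌋ then y (options v (x ∷ τ) f) else 1) * ∏ (allFin n) (λ v → rankWeight (λ u → G v (f u)) v τ)
      ≡⟨ ∏-* (allFin n) _ _ ⟨
    ∏ (allFin n) (λ v → rankWeight (λ u → G v (f u)) v (x ∷ τ)) ∎
    where open ≡-Reasoning

  t : ℕ
  t = length (orders n)

  module _ {σ : Vec (Fin n) n} (σ∈ : σ ∈ cycleFactors G) where

    private
      f = lookupᵥ σ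

    factor-injective : Injective _≡_ _≡_ f
    factor-injective = isInjective-elim σ (proj₁ (∧-elim (proj₂ (filterB-∈⁻ (allVecs n n) σ∈))))

    factor-edge : ∀ v → G v (f v) ≡ true
    factor-edge = allB-elim (proj₂ (∧-elim {isInjective σ} (proj₂ (filterB-∈⁻ (allVecs n n) σ∈))))

    -- For each v the relevant set D is the preimage under f of the out-neighbourhood of v. It has d
    -- elements because f is a permutation, and it contains v because v → f v is an edge, so
    -- `rankWeight-average` applies.
    ∏-optionWeight : ∏ (orders n) (λ τ → optionWeight (order τ) f) ^ d ≡ (yProduct d ^ n) ^ t
    ∏-optionWeight = begin
      ∏ (orders n) (λ τ → optionWeight (order τ) f) ^ d
        ≡⟨ cong (_^ d) (trans (∏-cong (orders n) (λ τ → optionWeight-rank (order τ) f)) (∏-swap (orders n) (allFin n) _)) ⟩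
      ∏ (allFin n) (λ v → ∏ (orders n) (λ τ → rankWeight (λ u → G v (f u)) v (order τ))) ^ d
        ≡⟨ ∏-^ d (allFin n) _ ⟨
      ∏ (allFin n) (λ v → ∏ (orders n) (λ τ → rankWeight (λ u → G v (f u)) v (order τ)) ^ d)
        ≡⟨ ∏-cong (allFin n) (λ v → rankWeight-average (λ u → G v (f u)) d (degree v) v (factor-edge v)) ⟩
      ∏ (allFin n) (λ _ → yProduct d ^ t)
        ≡⟨ trans (∏-const (yProduct d ^ t) (allFin n)) (cong ((yProduct d ^ t) ^_) (length-allFin n)) ⟩
      (yProduct d ^ t) ^ n
        ≡⟨ trans (^-*-assoc (yProduct d) t n) (trans (cong (yProduct d ^_) (*-comm t n)) (sym (^-*-assoc (yProduct d) n t))) ⟩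
      (yProduct d ^ n) ^ t ∎
      where
      open ≡-Reasoning
      degree : ∀ v → ∑ (allFin n) (λ u → 𝟙 (G v (f u))) ≡ d
      degree v = trans (∑-reindex factor-injective (injective⇒surjective factor-injective) (λ w → 𝟙 (G v w))) (proj₁ (reg v))

    -- AM-GM over the t orders. The product of the weights is known only through its d-th power, so
    -- the inequality is raised to d and the common exponent t is cancelled at the end.
    order-average : t ^ d * yProduct d ^ n ≤ ∑ (orders n) (λ τ → optionWeight (order τ) f) ^ d
    order-average = ^-cancelʳ-≤ t ⦃ >-nonZero (orders-nonempty {n}) ⦄ (begin
      (t ^ d * yProduct d ^ n) ^ t
        ≡⟨ ^-distribʳ-* (t ^ d) (yProduct d ^ n) t ⟩
      (t ^ d) ^ t * (yProduct d ^ n) ^ t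
        ≡⟨ cong₂ _*_ (^-exchange t d t) (sym ∏-optionWeight) ⟩
      (t ^ t) ^ d * ∏ (orders n) X ^ d
        ≡⟨ ^-distribʳ-* (t ^ t) (∏ (orders n) X) d ⟨
      (t ^ t * ∏ (orders n) X) ^ d
        ≤⟨ ^-monoˡ-≤ d (AM-GM (orders n) X) ⟩
      (∑ (orders n) X ^ t) ^ d
        ≡⟨ ^-exchange (∑ (orders n) X) t d ⟩
      (∑ (orders n) X ^ d) ^ t ∎)
      where
      open ≤-Reasoning
      X : Vec (Fin n) n → ℕ
      X τ = optionWeight (order τ) f

  exposure-order : ∀ {τ} → τ ∈ orders n → ∑ (cycleFactors G) (λ σ → pathWeight (order τ) id (lookupᵥ σ)) ≤ F ^ n
  exposure-order {τ} τ∈ = ≤-trans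
    (exposure-bound F (λ k k≤d → ≤-reflexive (y-exact k k≤d)) (order τ) id full (cycleFactors G)
      (filterB-unique (allVecs-unique n n))
      (λ _ _ x x∉ → ⊥-elim (x∉ (order-complete τ∈ x)))
      factor-edge
      (λ {σ} σ∈ h → trans (∑-order τ∈ (h ∘ lookupᵥ σ))
        (trans (∑-reindex (factor-injective σ∈) (injective⇒surjective (factor-injective σ∈)) h)
          (∑-cong (allFin n) (λ w → sym (*-identityˡ (h w)))))))
    (≤-reflexive (cong (F ^_) (trans (length-map (lookupᵥ τ) (allFin n)) (length-allFin n))))

  weighted-count : ∑ (cycleFactors G) (λ σ → 2 ^ numCycles σ * ∑ (orders n) (λ τ → optionWeight (order τ) (lookupᵥ σ))) ≤ t * F ^ n
  weighted-count = begin
    ∑ (cycleFactors G) (λ σ → 2 ^ numCycles σ * ∑ (orders n) (λ τ → optionWeight (order τ) (lookupᵥ σ)))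
      ≡⟨ ∑-cong (cycleFactors G) (λ σ → sym (∑-*ˡ (2 ^ numCycles σ) (orders n) _)) ⟩
    ∑ (cycleFactors G) (λ σ → ∑ (orders n) (λ τ → 2 ^ numCycles σ * optionWeight (order τ) (lookupᵥ σ)))
      ≤⟨ ∑-mono (cycleFactors G) (λ σ∈ → ∑-mono (orders n) (λ τ∈ → bound σ∈ τ∈)) ⟩
    ∑ (cycleFactors G) (λ σ → ∑ (orders n) (λ τ → pathWeight (order τ) id (lookupᵥ σ)))
      ≡⟨ ∑-swap (cycleFactors G) (orders n) _ ⟩
    ∑ (orders n) (λ τ → ∑ (cycleFactors G) (λ σ → pathWeight (order τ) id (lookupᵥ σ)))
      ≤⟨ ∑-mono (orders n) exposure-order ⟩
    ∑ (orders n) (λ _ → F ^ n)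
      ≡⟨ ∑-const (F ^ n) (orders n) ⟩
    t * F ^ n ∎
    where
    open ≤-Reasoning
    bound : ∀ {σ τ} → σ ∈ cycleFactors G → τ ∈ orders n →
            2 ^ numCycles σ * optionWeight (order τ) (lookupᵥ σ) ≤ pathWeight (order τ) id (lookupᵥ σ)
    bound {σ} {τ} σ∈ τ∈ = ≤-trans
      (*-monoˡ-≤ (optionWeight (order τ) (lookupᵥ σ))
        (^-monoʳ-≤ 2 (numCycles≤closing σ (factor-injective σ∈) (order τ) (order-unique τ∈) (order-complete τ∈))))
      (≤-reflexive (sym (pathWeight-closing (order τ) id (lookupᵥ σ))))

  cycle-generating-bound : ∑ (cycleFactors G) (λ σ → 2 ^ numCycles σ) ^ d ≤ F ^ n
  cycle-generating-bound = *-cancelʳ-≤ _ _ (t ^ d * Y) ⦃ m*n≢0 (t ^ d) Y ⦃ m^n≢0 t d ⦄ ⦃ m^n≢0 (yProduct d) n ⦄ ⦄ (begin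
    Z ^ d * (t ^ d * Y)                ≤⟨ weighted-sum-power d (t ^ d * Y) (cycleFactors G) _ _ order-average ⟩
    _                                  ≤⟨ ^-monoˡ-≤ d weighted-count ⟩
    (t * F ^ n) ^ d                    ≡⟨ ^-distribʳ-* t (F ^ n) d ⟩
    -- At k = d the identity `yProduct-exact` reads `F * yProduct d ≡ F ^ d`, since F is itself
    -- (d+1)!. So cancelling Y leaves just `F ^ n`.
    t ^ d * (F ^ n) ^ d                ≡⟨ cong (t ^ d *_) (trans (^-exchange F n d) (trans (cong (_^ n) (sym (yProduct-exact d ≤-refl))) (^-distribʳ-* F (yProduct d) n))) ⟩
    t ^ d * (F ^ n * Y)                ≡⟨ swap₃ (t ^ d) (F ^ n) Y ⟩
    F ^ n * (t ^ d * Y)                ∎)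
    where
    open ≤-Reasoning
    Z = ∑ (cycleFactors G) (λ σ → 2 ^ numCycles σ)
    Y = yProduct d ^ n
    swap₃ : ∀ a b c → a * (b * c) ≡ b * (a * c)
    swap₃ = solve-∀
    instance
      t≢0 : NonZero t
      t≢0 = >-nonZero (orders-nonempty {n})
      yProduct≢0 : NonZero (yProduct d)
      yProduct≢0 = m*n≢0⇒n≢0 (suc d !) ⦃ subst NonZero (sym (yProduct-exact d ≤-refl)) (m^n≢0 F d) ⦄

-- From the ratio Z₂ / Z₁ to the expected number of cycles.

1+j≤2^j : ∀ j → 1 + j ≤ 2 ^ j
1+j≤2^j zero    = ≤-refl
1+j≤2^j (suc j) = +-mono-≤ (m^n>0 2 j) (≤-trans (1+j≤2^j j) (m≤m+n (2 ^ j) 0))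

-- A supporting line of 2ᶜ on the integers, with slope 2ᵗ, that of the chord from t to t + 1. For c
-- ≥ t it is Bernoulli's inequality for c - t; for c < t the line is not positive.
2^-tangent : ∀ t c → 2 ^ t * (1 + c) ≤ 2 ^ c + t * 2 ^ t
2^-tangent t c with t ≤? c
... | no  t≰c = ≤-trans (*-monoʳ-≤ (2 ^ t) (≰⇒> t≰c)) (≤-trans (≤-reflexive (*-comm (2 ^ t) t)) (m≤n+m _ (2 ^ c)))
... | yes t≤c with j , refl ← m≤n⇒∃[o]m+o≡n t≤c = begin
  2 ^ t * (1 + (t + j))          ≡⟨ regroup (2 ^ t) t j ⟩
  2 ^ t * (1 + j) + t * 2 ^ t    ≤⟨ +-monoˡ-≤ (t * 2 ^ t) (*-monoʳ-≤ (2 ^ t) (1+j≤2^j j)) ⟩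
  2 ^ t * 2 ^ j + t * 2 ^ t      ≡⟨ cong (_+ t * 2 ^ t) (^-distribˡ-+-* 2 t j) ⟨
  2 ^ (t + j) + t * 2 ^ t        ∎
  where
  open ≤-Reasoning
  regroup : ∀ p t j → p * (1 + (t + j)) ≡ p * (1 + j) + t * p
  regroup = solve-∀

jensen-2^ : {A : Set} (xs : List A) (c : A → ℕ) (t : ℕ) →
            ∑ xs (λ x → 2 ^ c x) ≤ 2 ^ t * length xs → ∑ xs c ≤ t * length xs
jensen-2^ xs c t h = *-cancelˡ-≤ (2 ^ t) ⦃ m^n≢0 2 t ⦄ (+-cancelˡ-≤ (2 ^ t * ℓ) _ _ (begin
  2 ^ t * ℓ + 2 ^ t * ∑ xs c                  ≡⟨ *-distribˡ-+ (2 ^ t) ℓ (∑ xs c) ⟨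
  2 ^ t * (ℓ + ∑ xs c)                        ≡⟨ cong (λ z → 2 ^ t * (z + ∑ xs c)) (length-∑ xs) ⟩
  2 ^ t * (∑ xs (λ _ → 1) + ∑ xs c)           ≡⟨ cong (2 ^ t *_) (∑-+ xs (λ _ → 1) c) ⟨
  2 ^ t * ∑ xs (λ x → 1 + c x)                ≡⟨ ∑-*ˡ (2 ^ t) xs _ ⟨
  ∑ xs (λ x → 2 ^ t * (1 + c x))              ≤⟨ ∑-mono xs (λ {x} _ → 2^-tangent t (c x)) ⟩
  ∑ xs (λ x → 2 ^ c x + t * 2 ^ t)            ≡⟨ ∑-+ xs (λ x → 2 ^ c x) (λ _ → t * 2 ^ t) ⟩
  ∑ xs (λ x → 2 ^ c x) + ∑ xs (λ _ → t * 2 ^ t) ≤⟨ +-mono-≤ h (≤-reflexive (∑-const (t * 2 ^ t) xs)) ⟩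
  2 ^ t * ℓ + ℓ * (t * 2 ^ t)                 ≡⟨ cong (2 ^ t * ℓ +_) (regroup (2 ^ t) ℓ t) ⟩
  2 ^ t * ℓ + 2 ^ t * (t * ℓ)                 ∎))
  where
  open ≤-Reasoning
  ℓ = length xs
  regroup : ∀ p ℓ t → ℓ * (t * p) ≡ p * (t * ℓ)
  regroup = solve-∀

n<2^[1+log₂n] : ∀ n → n < 2 ^ suc ⌊log₂ n ⌋
n<2^[1+log₂n] n with n <? 2 ^ suc ⌊log₂ n ⌋
... | yes lt = lt
... | no  ¬lt = contradiction (≤-trans (≤-reflexive (sym (⌊log₂[2^n]⌋≡n (suc ⌊log₂ n ⌋)))) (⌊log₂⌋-mono-≤ (≮⇒≥ ¬lt))) 1+n≰n

degree≤order : ∀ {n d} {G : Digraph n} → 1 ≤ n → Regular d G → d ≤ n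
degree≤order {suc n} {d} {G} _ reg = begin
  d                                              ≡⟨ proj₁ (reg zero) ⟨
  ∑ (allFin (suc n)) (λ u → 𝟙 (G zero u))        ≤⟨ ∑-mono (allFin (suc n)) (λ {u} _ → 𝟙≤1 (G zero u)) ⟩
  ∑ (allFin (suc n)) (λ _ → 1)                   ≡⟨ length-∑ (allFin (suc n)) ⟨
  length (allFin (suc n))                        ≡⟨ length-allFin (suc n) ⟩
  suc n                                          ∎
  where
  open ≤-Reasoning
  𝟙≤1 : ∀ b → 𝟙 b ≤ 1
  𝟙≤1 true  = ≤-refl
  𝟙≤1 false = z≤n

module _ {n : ℕ} (k : ℕ) (G : Digraph n) (reg : Regular (2 + k) G) where

  private
    e d Z₁ Z₂ : ℕ
    e  = suc k
    d  = suc e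
    Z₁ = length (cycleFactors G)
    Z₂ = ∑ (cycleFactors G) (λ σ → 2 ^ numCycles σ)

  generating-ratio : Z₂ ^ d ≤ d ^ (5 * n) * Z₁ ^ d
  -- The factor clears the denominators of the lower bound for Z₁, which are (dᵈ)ⁿ before the d-th
  -- power.
  generating-ratio = *-cancelʳ-≤ _ _ (((d ^ d) ^ d) ^ n) ⦃ m^n≢0 ((d ^ d) ^ d) n ⦃ m^n≢0 (d ^ d) d ⦃ m^n≢0 d d ⦄ ⦄ ⦄ (begin
    Z₂ ^ d * P ^ n
      ≤⟨ *-monoˡ-≤ (P ^ n) (UpperBound.cycle-generating-bound G reg) ⟩
    (suc d !) ^ n * P ^ n
      ≡⟨ ^-distribʳ-* (suc d !) P n ⟨
    (suc d ! * P) ^ n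
      ≤⟨ ^-monoˡ-≤ n (stirling-gap k) ⟩
    (d ^ 5 * (d ^ d * (e ^ d) ^ d)) ^ n
      ≡⟨ trans (^-distribʳ-* (d ^ 5) _ n) (cong₂ _*_ (^-*-assoc d 5 n) outer-power) ⟩
    d ^ (5 * n) * (d ^ n * (e ^ d) ^ n) ^ d
      ≤⟨ *-monoʳ-≤ (d ^ (5 * n)) (^-monoˡ-≤ d count) ⟩
    d ^ (5 * n) * ((d ^ d) ^ n * Z₁) ^ d
      ≡⟨ cong (d ^ (5 * n) *_) (trans (^-distribʳ-* ((d ^ d) ^ n) Z₁ d) (cong (_* Z₁ ^ d) (^-exchange (d ^ d) n d))) ⟩
    d ^ (5 * n) * (P ^ n * Z₁ ^ d)
      ≡⟨ regroup (d ^ (5 * n)) (P ^ n) (Z₁ ^ d) ⟩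
    d ^ (5 * n) * Z₁ ^ d * P ^ n ∎)
    where
    open ≤-Reasoning
    P = (d ^ d) ^ d
    regroup : ∀ a b c → a * (b * c) ≡ a * c * b
    regroup = solve-∀
    outer-power : (d ^ d * (e ^ d) ^ d) ^ n ≡ (d ^ n * (e ^ d) ^ n) ^ d
    outer-power = trans (cong (_^ n) (sym (^-distribʳ-* d (e ^ d) d)))
      (trans (^-exchange (d * e ^ d) d n) (cong (_^ d) (^-distribʳ-* d (e ^ d) n)))
    count : d ^ n * (e ^ d) ^ n ≤ (d ^ d) ^ n * Z₁
    count = ≤-trans (LowerBound.Φ-lower-bound G reg e (s≤s z≤n)) (*-monoʳ-≤ ((d ^ d) ^ n) (Φ≤cycleFactors G))

  expected-cycles : 1 ≤ n → d * ∑ (cycleFactors G) numCycles ≤ 11 * n * ⌊log₂ d ⌋ * Z₁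
  expected-cycles 1≤n = begin
    d * ∑ (cycleFactors G) numCycles   ≤⟨ *-monoʳ-≤ d (jensen-2^ (cycleFactors G) numCycles t Z₂≤) ⟩
    d * (t * Z₁)                       ≡⟨ *-assoc d t Z₁ ⟨
    d * t * Z₁                         ≤⟨ *-monoˡ-≤ Z₁ dt≤ ⟩
    11 * n * L * Z₁                    ∎
    where
    open ≤-Reasoning
    L = ⌊log₂ d ⌋
    -- `2 ^ E` bounds `d ^ (5 * n)`: from L ≥ 1 follows d < 2^(L+1) ≤ 2^(2L).
    E = (2 * L) * (5 * n)
    -- `jensen-2^` needs an integer exponent with E ≤ t d, so the quotient is rounded up.
    t = suc (E / d)
    1≤L : 1 ≤ L
    1≤L = ⌊log₂⌋-mono-≤ {2} {d} (s≤s (s≤s z≤n))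
    E≤td : E ≤ t * d
    E≤td = begin
      E                     ≡⟨ m≡m%n+[m/n]*n E d ⟩
      E % d + E / d * d     ≤⟨ +-monoˡ-≤ (E / d * d) (<⇒≤ (m%n<n E d)) ⟩
      t * d                 ∎
    d≤2^2L : d ≤ 2 ^ (2 * L)
    d≤2^2L = ≤-trans (<⇒≤ (n<2^[1+log₂n] d)) (^-monoʳ-≤ 2 (+-mono-≤ 1≤L (m≤m+n L 0)))
    Z₂≤ : Z₂ ≤ 2 ^ t * Z₁
    Z₂≤ = ^-cancelʳ-≤ d (begin
      Z₂ ^ d                          ≤⟨ generating-ratio ⟩
      d ^ (5 * n) * Z₁ ^ d            ≤⟨ *-monoˡ-≤ (Z₁ ^ d) (^-monoˡ-≤ (5 * n) d≤2^2L) ⟩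
      (2 ^ (2 * L)) ^ (5 * n) * Z₁ ^ d ≡⟨ cong (_* Z₁ ^ d) (^-*-assoc 2 (2 * L) (5 * n)) ⟩
      2 ^ E * Z₁ ^ d                  ≤⟨ *-monoˡ-≤ (Z₁ ^ d) (^-monoʳ-≤ 2 E≤td) ⟩
      2 ^ (t * d) * Z₁ ^ d            ≡⟨ cong (_* Z₁ ^ d) (^-*-assoc 2 t d) ⟨
      (2 ^ t) ^ d * Z₁ ^ d            ≡⟨ ^-distribʳ-* (2 ^ t) Z₁ d ⟨
      (2 ^ t * Z₁) ^ d                ∎)
    dt≤ : d * t ≤ 11 * n * L
    dt≤ = begin
      d * t                ≡⟨ trans (*-suc d (E / d)) (cong (d +_) (*-comm d (E / d))) ⟩
      -- The rounding costs one d ≤ n ≤ n L. Added to E = 10 n L it makes the constant 11.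
      d + E / d * d        ≤⟨ +-mono-≤ (degree≤order 1≤n reg) (m/n*n≤m E d) ⟩
      n + E                ≤⟨ +-monoˡ-≤ E (m≤m*n n L ⦃ >-nonZero 1≤L ⦄) ⟩
      n * L + E            ≡⟨ regroup n L ⟩
      11 * n * L           ∎
      where
      regroup : ∀ n L → n * L + (2 * L) * (5 * n) ≡ 11 * n * L
      regroup = solve-∀

theorem1p1 : ∃[ C ] (1 ≤ C × ((d n : ℕ) → 2 ≤ d → 1 ≤ n → (G : Digraph n) → Regular d G →
    d * sum (map numCycles (cycleFactors G))
    ≤ C * n * ⌊log₂ d ⌋ * length (cycleFactors G)))
theorem1p1 = 11 , s≤s z≤n , λ where
  (suc zero)    n (s≤s ())
  (suc (suc k)) n 2≤d 1≤n G reg → expected-cycles k G reg 1≤n
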